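{- Let $n\ge3$ and $S\subseteq[3,n]$ with $CP_n(S)\ne\emptyset$, and suppose $S$ has type $(r_1^{k_1},r_2^{k_2},\dots,r_m^{k_m})$ with $m\ge2$. Then, with $i_0=0$, $$cp_n(S)=2^{n-r_m}\sum_{i_1=0}^{k_m}\sum_{i_2=0}^{k_{m-1}+i_1}\cdots\sum_{i_{m-1}=0}^{k_2+i_{m-2}}\ \prod_{j=1}^{m-1}w\big(i_j,\,r_{m-j},\,r_{m-j+1}+i_{j-1}-i_j,\,k_{m-j+1}+i_{j-1}-i_j\big)\ cp_{r_1+i_{m-1}}\big([r_1-k_1+1,\,r_1+i_{m-1}]\big).$$
   Context: For integers $a \le b$, $[a,b]=\{a,a+1,\dots,b\}$, $[a,b]=\emptyset$ if $a>b$, and $[n]=[1,n]$. For $N\ge1$, $\mathfrak{S}_N$ is the set of permutations of $[N]$, in one-line form $\sigma=(\sigma(1)\cdots\sigma(N))$; $CP(\sigma)=\{\sigma(i) : 2\le i\le N-1,\ \sigma(i-1)<\sigma(i)>\sigma(i+1)\}$; for $T\subseteq[N]$, $CP_N(T)=\{\sigma\in\mathfrak{S}_N : CP(\sigma)=T\}$ and $cp_N(T)=|CP_N(T)|$. Type: a set $S\subseteq[3,n]$ has type $(r_1^{k_1},\dots,r_m^{k_m})$ (with positive integers $k_i$) if $S=\bigcup_{i=1}^m[r_i-k_i+1,r_i]$ and $r_i\le r_{i+1}-k_{i+1}-1$ for all $i\in[1,m-1]$. Circular-peak paths and $w$: a circular-peak path from $(r,0)$ to $(N,k)$ is a lattice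 path in the first quadrant from $(r,0)$ to $(N,k)$ using only steps $H=(1,0)$ and $R=(2,1)$; $P_{r,N,k}$ is the set of such paths. For an integer $i$, an $H$-step from $(x,y)$ to $(x+1,y)$ has weight $2i+2(y+1)$, and an $R$-step from $(x,y)$ to $(x+2,y+1)$ has weight $(y+i+1)(y+i+2)$; $w_i(P)$ is the product of the step weights of $P$, and $w(i,r,N,k)=\sum_{P\in P_{r,N,k}}w_i(P)$ (an empty sum being $0$). -}

module Defs where

open import Data.Nat using (ℕ; zero; suc; _+_; _*_; _∸_; _^_; _≤_; _<_; _<?_; _≟_)
open import Data.Nat.Properties using ()
open import Data.Bool using (Bool; true; false; _∧_; if_then_else_)
open import Data.List using (List; []; _∷_; [_]; map; concatMap; upTo; length; filter; reverse)
open import Data.Nat.ListAction using (sum)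
open import Data.Product using (_×_; _,_; proj₁; proj₂)
open import Relation.Nullary using (does; Dec)
open import Relation.Nullary.Decidable using (_×-dec_)
open import Relation.Unary using (Decidable)
open import Relation.Binary.PropositionalEquality using (_≡_; _≢_)
open import Data.Product.Properties using (≡-dec)
open import Data.List.Relation.Unary.Unique.DecPropositional _≟_ using (Unique; unique?)
open import Data.List.Relation.Binary.Subset.DecPropositional _≟_ using (_⊆_; _⊆?_)

interval : ℕ → ℕ → List ℕ
interval a b = map (a +_) (upTo (suc b ∸ a))

-- Permutations in one-line form.  A permutation σ ∈ 𝔖_N is represented
-- by the list (σ(1) ⋯ σ(N)).  We enumerate all words of length N over
-- the alphabet [1,N] and keep the ones without repeated letters.

words : ℕ → List ℕ → List (List ℕ)
words zero    A = [ [] ]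
words (suc l) A = concatMap (λ a → map (a ∷_) (words l A)) A

IsPerm : List ℕ → Set
IsPerm σ = Unique σ

perms : ℕ → List (List ℕ)
perms N = filter unique? (words N (interval 1 N))

CP : List ℕ → List ℕ
CP (a ∷ b ∷ c ∷ rest) =
  (if does (a <? b) ∧ does (c <? b) then (b ∷_) else (λ xs → xs)) (CP (b ∷ c ∷ rest))
CP _ = []

CPis : List ℕ → List ℕ → Set
CPis T σ = (CP σ ⊆ T) × (T ⊆ CP σ)

CPis? : (T : List ℕ) → Decidable (CPis T)
CPis? T σ = (CP σ ⊆? T) ×-dec (T ⊆? CP σ)

CPset : ℕ → List ℕ → List (List ℕ)
CPset N T = filter (CPis? T) (perms N)

cp : ℕ → List ℕ → ℕ
cp N T = length (CPset N T)

-- Circular-peak paths from (r,0) to (N,k) with steps H = (1,0), R = (2,1).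

data Step : Set where
  H R : Step

stepSeqs : ℕ → List (List Step)
stepSeqs zero    = [ [] ]
stepSeqs (suc l) = [] ∷ concatMap (λ s → map (s ∷_) (stepSeqs l)) (H ∷ R ∷ [])

endpoint : ℕ × ℕ → List Step → ℕ × ℕ
endpoint p       []      = p
endpoint (x , y) (H ∷ P) = endpoint (suc x , y) P
endpoint (x , y) (R ∷ P) = endpoint (x + 2 , suc y) P

EndsAt : ℕ → ℕ → ℕ → List Step → Set
EndsAt r N k P = endpoint (r , 0) P ≡ (N , k)

EndsAt? : (r N k : ℕ) → Decidable (EndsAt r N k)
EndsAt? r N k P = ≡-dec _≟_ _≟_ (endpoint (r , 0) P) (N , k)

-- P_{r,N,k}: every step increases x by at least 1, so paths from (r,0) to
-- (N,k) have at most N ∸ r steps; all such sequences stay in the first quadrant.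
paths : ℕ → ℕ → ℕ → List (List Step)
paths r N k = filter (EndsAt? r N k) (stepSeqs (N ∸ r))

weightFrom : ℕ → ℕ × ℕ → List Step → ℕ
weightFrom i p       []      = 1
weightFrom i (x , y) (H ∷ P) = (2 * i + 2 * (y + 1)) * weightFrom i (suc x , y) P
weightFrom i (x , y) (R ∷ P) = ((y + i + 1) * (y + i + 2)) * weightFrom i (x + 2 , suc y) P

w : ℕ → ℕ → ℕ → ℕ → ℕ
w i r N k = sum (map (weightFrom i (r , 0)) (paths r N k))

-- Sets of given type.  A type (r_1^{k_1},...,r_m^{k_m}) is a list of
-- pairs (r_i , k_i) in increasing order of i.

setOfType : List (ℕ × ℕ) → List ℕ
setOfType bs = concatMap (λ b → interval (suc (proj₁ b) ∸ proj₂ b) (proj₁ b)) bs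

-- the spacing condition r_i ≤ r_{i+1} - k_{i+1} - 1, i.e. r_i + k_{i+1} + 1 ≤ r_{i+1}
data Spaced : List (ℕ × ℕ) → Set where
  sp[]  : Spaced []
  sp[-] : ∀ {b} → Spaced [ b ]
  sp∷   : ∀ {r k r' k' bs} → r + k' + 1 ≤ r' →
          Spaced ((r' , k') ∷ bs) → Spaced ((r , k) ∷ (r' , k') ∷ bs)

Σto : ℕ → (ℕ → ℕ) → ℕ
Σto b f = sum (map f (upTo (suc b)))

-- The nested sum.  The argument is the list of blocks in DEcreasing order
-- (r_m,k_m), (r_{m-1},k_{m-1}), ..., (r_1,k_1), and ip is the previous index
-- i_{j-1} (i_0 = 0).  With top block (r,k) = (r_{m-j+1},k_{m-j+1}) and next
-- block r' = r_{m-j}, the index i_j ranges over [0, k + i_{j-1}] and the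
-- factor is w(i_j, r_{m-j}, r_{m-j+1}+i_{j-1}-i_j, k_{m-j+1}+i_{j-1}-i_j).
-- At the last block (r_1,k_1) the factor cp_{r_1+i_{m-1}}([r_1-k_1+1, r_1+i_{m-1}]).
nested : ℕ → List (ℕ × ℕ) → ℕ
nested ip []                   = 0
nested ip ((r , k) ∷ [])       = cp (r + ip) (interval (suc r ∸ k) (r + ip))
nested ip ((r , k) ∷ (r' , k') ∷ bs) =
  Σto (k + ip) (λ i → w i r' (r + ip ∸ i) (k + ip ∸ i) * nested i ((r' , k') ∷ bs))

{-# OPTIONS --safe #-}
module Submission where

-- Deleting from a permutation all letters larger than v leaves c blocks of consecutive letters.
-- Letting v grow from 1 to N, a letter outside the peak set either opens a new block (c + 1 positions
-- afterwards) or extends one of the c blocks at an end (2c ways), while a peak glues two adjacent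
-- blocks; `transfer` evaluates the resulting weighted walk from the top letter down.  That it counts
-- permutations by peak set is proved by inserting the largest letter: at an end it changes no peak,
-- inside it becomes a peak and destroys an adjacent peak if there is one.  The same recursion holds for
-- `transfer`, by `cut-identity`.
--
-- For the formula, a block of k peaks read at state i + 1 contributes (k + i)!/i! and moves to state
-- k + i + 1, and a gap without peaks acts by walks with level steps (weight 2c) and up steps.  A
-- circular-peak path records such a walk at c = i + y + 1: its R-steps carry both the factor c + 1 of an
-- up step and a factor c, the latter accounting for the quotient of factorials between both ends.

open import Defs
open import Data.Bool using (Bool; true; false; if_then_else_; _∧_)
open import Data.List using (List; _∷_; []; [_]; _++_; _∷ʳ_; reverse; length; replicate; map; concatMap;
  filter; foldl; upTo; applyUpTo)
open import Data.List.Membership.Propositional using (_∈_; _∉_; find; lose)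
open import Data.List.Membership.Propositional.Properties
open import Data.List.Membership.Propositional.Properties.WithK using (unique∧set⇒bag)
open import Data.List.Properties using (map-cong; map-∘; map-++; map-upTo; applyUpTo-∷ʳ; ++-identityʳ; reverse-++;
  filter-all; filter-reject; filter-accept; ∷-injectiveˡ; ∷-injectiveʳ)
open import Data.List.Relation.Binary.BagAndSetEquality using (∼bag⇒↭)
open import Data.List.Relation.Binary.Permutation.Propositional using (_↭_; refl; prep; swap; ↭-sym; ↭⇒↭ₛ)
open import Data.List.Relation.Binary.Permutation.Propositional.Properties
  using (shift; All-resp-↭; ∈-resp-↭; ↭-length; map⁺)
open import Data.List.Relation.Binary.Permutation.Setoid.Properties using (Unique-resp-↭)
open import Data.List.Relation.Unary.All as All using (All; []; _∷_)
open import Data.List.Relation.Unary.Any using (here; there)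
open import Data.List.Relation.Unary.Any.Properties using (reverse⁺; reverse⁻)
open import Data.List.Relation.Unary.Unique.Propositional using (Unique; []; _∷_)
import Data.List.Relation.Unary.Unique.Propositional.Properties as Unique
open import Data.Nat using (ℕ; zero; suc; pred; _+_; _*_; _∸_; _^_; _!; _≤_; _<_; _<?_; _≟_; s≤s; z≤n)
open import Data.List.Membership.DecPropositional _≟_ using (_∈?_)
open import Data.List.Relation.Unary.Unique.DecPropositional _≟_ using (unique?)
open import Data.Nat.ListAction using (sum)
open import Data.Nat.ListAction.Properties using (sum-++; sum-↭)
open import Data.Nat.Properties
open import Data.Nat.Tactic.RingSolver using (solve-∀)
open import Data.Product using (_×_; _,_; ∃-syntax; proj₁; proj₂)
open import Data.Product.Properties using (≡-dec)
open import Data.Sum using (_⊎_; inj₁; inj₂)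
open import Function using (_∘_; flip; mk⇔)
open import Relation.Binary.PropositionalEquality using (_≡_; _≢_; refl; sym; trans; cong; cong₂;
  subst; subst₂; ≢-sym; setoid; module ≡-Reasoning)
open import Relation.Nullary using (Dec; yes; no; does; contradiction; ¬_; ¬?)
open import Relation.Nullary.Decidable using (dec-true; dec-false; does-⇔)

-- The weighted walk on the number of blocks

-- The state `c` is the number of blocks once the letter of the head bit is placed. A peak came from
-- `suc c` blocks, which have `c` adjacent pairs to glue; any other letter is itself one of the `c`
-- blocks or one of their `2 * c` ends. At state 0 the factor `c` annihilates the default `pred 0`.
transfer : List Bool → ℕ → ℕ
transfer []           zero    = 1
transfer []           (suc _) = 0
transfer (true  ∷ bs) c       = c * transfer bs (suc c)
transfer (false ∷ bs) c       = c * (transfer bs (pred c) + 2 * transfer bs c)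

ones : List Bool → ℕ
ones []           = 0
ones (true  ∷ bs) = suc (ones bs)
ones (false ∷ bs) = ones bs

-- These are the patterns with one peak more than `bs`: destroying that peak leads back to `bs`,
-- which is how they enter the insertion recursion.
upSum : (List Bool → ℕ) → List Bool → ℕ
upSum f []           = 0
upSum f (true  ∷ bs) = upSum (f ∘ (true ∷_)) bs
upSum f (false ∷ bs) = f (true ∷ bs) + upSum (f ∘ (false ∷_)) bs

upSum-cong : ∀ {f g} bs → (∀ d → length d ≡ length bs → f d ≡ g d) → upSum f bs ≡ upSum g bs
upSum-cong []           f≗g = refl
upSum-cong (true  ∷ bs) f≗g = upSum-cong bs (λ d e → f≗g (true ∷ d) (cong suc e))
upSum-cong (false ∷ bs) f≗g =
  cong₂ _+_ (f≗g _ refl) (upSum-cong bs (λ d e → f≗g (false ∷ d) (cong suc e)))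

upSum-+ : ∀ f g bs → upSum (λ d → f d + g d) bs ≡ upSum f bs + upSum g bs
upSum-+ f g []           = refl
upSum-+ f g (true  ∷ bs) = upSum-+ (f ∘ (true ∷_)) (g ∘ (true ∷_)) bs
upSum-+ f g (false ∷ bs) = trans
  (cong (f (true ∷ bs) + g (true ∷ bs) +_) (upSum-+ (f ∘ (false ∷_)) (g ∘ (false ∷_)) bs))
  (interchange (f (true ∷ bs)) _ _ _)
  where
  interchange : ∀ a b c d → a + b + (c + d) ≡ a + c + (b + d)
  interchange = solve-∀

upSum-* : ∀ k f bs → upSum (λ d → k * f d) bs ≡ k * upSum f bs
upSum-* k f []           = sym (*-zeroʳ k)
upSum-* k f (true  ∷ bs) = upSum-* k (f ∘ (true ∷_)) bs
upSum-* k f (false ∷ bs) = trans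
  (cong (k * f (true ∷ bs) +_) (upSum-* k (f ∘ (false ∷_)) bs))
  (sym (*-distribˡ-+ k (f (true ∷ bs)) _))

upSum-0 : ∀ bs → upSum (λ _ → 0) bs ≡ 0
upSum-0 []           = refl
upSum-0 (true  ∷ bs) = upSum-0 bs
upSum-0 (false ∷ bs) = upSum-0 bs

upSum-transfer-false : ∀ c bs → upSum (λ d → transfer (false ∷ d) c) bs ≡
  c * (upSum (λ d → transfer d (pred c)) bs + 2 * upSum (λ d → transfer d c) bs)
upSum-transfer-false c bs = begin
  upSum (λ d → c * (transfer d (pred c) + 2 * transfer d c)) bs
    ≡⟨ upSum-* c _ bs ⟩
  c * upSum (λ d → transfer d (pred c) + 2 * transfer d c) bs
    ≡⟨ cong (c *_) (upSum-+ _ _ bs) ⟩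
  c * (upSum (λ d → transfer d (pred c)) bs + upSum (λ d → 2 * transfer d c) bs)
    ≡⟨ cong (λ z → c * (upSum (λ d → transfer d (pred c)) bs + z)) (upSum-* 2 _ bs) ⟩
  c * (upSum (λ d → transfer d (pred c)) bs + 2 * upSum (λ d → transfer d c) bs) ∎
  where open ≡-Reasoning

-- Both sides count the configurations of c blocks on N letters together with a further cut: a cut next
-- to a peak destroys it (two cuts for each peak), any other of the N - c slots keeps the peaks.  Terms
-- are moved so that no subtraction occurs.
cut-identity : ∀ bs c →
  c * transfer bs (suc c) + (c + 2 * ones bs) * transfer bs c ≡
  length bs * transfer bs c + 2 * upSum (λ d → transfer d c) bs
cut-identity [] zero    = refl
cut-identity [] (suc c) = cong₂ _+_ (*-zeroʳ c) (*-zeroʳ (suc c + 0))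
cut-identity (true ∷ bs) c = begin
  c * (suc c * g₂) + (c + 2 * suc t) * (c * g₁)
    ≡⟨ expand c t g₁ g₂ ⟩
  c * (suc c * g₂ + (suc c + 2 * t) * g₁) + c * g₁
    ≡⟨ cong (λ z → c * z + c * g₁) (cut-identity bs (suc c)) ⟩
  c * (n * g₁ + 2 * u) + c * g₁
    ≡⟨ collect c n g₁ u ⟩
  suc n * (c * g₁) + 2 * (c * u)
    ≡⟨ cong (λ z → suc n * (c * g₁) + 2 * z) (upSum-* c _ bs) ⟨
  suc n * (c * g₁) + 2 * upSum (λ d → c * transfer d (suc c)) bs ∎
  where
  open ≡-Reasoning
  t = ones bs
  n = length bs
  g₁ = transfer bs (suc c)
  g₂ = transfer bs (suc (suc c))
  u = upSum (λ d → transfer d (suc c)) bs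
  expand : ∀ c t g₁ g₂ → c * (suc c * g₂) + (c + 2 * suc t) * (c * g₁) ≡
                         c * (suc c * g₂ + (suc c + 2 * t) * g₁) + c * g₁
  expand = solve-∀
  collect : ∀ c n g₁ u → c * (n * g₁ + 2 * u) + c * g₁ ≡ suc n * (c * g₁) + 2 * (c * u)
  collect = solve-∀
cut-identity (false ∷ bs) zero = sym (trans
  (cong (λ z → suc (length bs) * 0 + 2 * z) (upSum-transfer-false 0 bs))
  (trans (cong (_+ 0) (*-zeroʳ (length bs))) (sym (*-zeroʳ (2 * ones bs)))))
cut-identity (false ∷ bs) (suc c) = begin
  suc c * (suc (suc c) * (g₁ + 2 * g₂)) + (suc c + 2 * t) * (suc c * (g₀ + 2 * g₁))
    ≡⟨ expand c t g₀ g₁ g₂ ⟩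
  suc c * (c * g₁ + (c + 2 * t) * g₀) + 2 * suc c * (suc c * g₂ + (suc c + 2 * t) * g₁) +
    suc c * (g₀ + 2 * g₁ + 2 * g₂)
    ≡⟨ cong₂ (λ y z → suc c * y + 2 * suc c * z + suc c * (g₀ + 2 * g₁ + 2 * g₂))
             (cut-identity bs c) (cut-identity bs (suc c)) ⟩
  suc c * (n * g₀ + 2 * u₀) + 2 * suc c * (n * g₁ + 2 * u₁) + suc c * (g₀ + 2 * g₁ + 2 * g₂)
    -- The remainder is one copy of `transfer (false ∷ bs) (suc c)`, which turns `n` into `suc n`,
    -- plus twice `transfer (true ∷ bs) (suc c)`, the new head term of `upSum`.
    ≡⟨ collect c n g₀ g₁ g₂ u₀ u₁ ⟩
  suc n * (suc c * (g₀ + 2 * g₁)) + 2 * (suc c * g₂ + suc c * (u₀ + 2 * u₁))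
    ≡⟨ cong (λ z → suc n * (suc c * (g₀ + 2 * g₁)) + 2 * (suc c * g₂ + z))
            (upSum-transfer-false (suc c) bs) ⟨
  suc n * (suc c * (g₀ + 2 * g₁)) +
    2 * (suc c * g₂ + upSum (λ d → transfer (false ∷ d) (suc c)) bs) ∎
  where
  open ≡-Reasoning
  t = ones bs
  n = length bs
  g₀ = transfer bs c
  g₁ = transfer bs (suc c)
  g₂ = transfer bs (suc (suc c))
  u₀ = upSum (λ d → transfer d c) bs
  u₁ = upSum (λ d → transfer d (suc c)) bs
  expand : ∀ c t g₀ g₁ g₂ →
    suc c * (suc (suc c) * (g₁ + 2 * g₂)) + (suc c + 2 * t) * (suc c * (g₀ + 2 * g₁)) ≡
    suc c * (c * g₁ + (c + 2 * t) * g₀) + 2 * suc c * (suc c * g₂ + (suc c + 2 * t) * g₁) +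
      suc c * (g₀ + 2 * g₁ + 2 * g₂)
  expand = solve-∀
  collect : ∀ c n g₀ g₁ g₂ u₀ u₁ →
    suc c * (n * g₀ + 2 * u₀) + 2 * suc c * (n * g₁ + 2 * u₁) + suc c * (g₀ + 2 * g₁ + 2 * g₂) ≡
    suc n * (suc c * (g₀ + 2 * g₁)) + 2 * (suc c * g₂ + suc c * (u₀ + 2 * u₁))
  collect = solve-∀

-- Peak sets as bit lists

InRange : ℕ → List ℕ → Set
InRange N = All (λ x → 1 ≤ x × x ≤ N)

InRange-shrink : ∀ {N p} → InRange (suc N) p → suc N ∉ p → InRange N p
InRange-shrink []                   _  = []
InRange-shrink ((1≤x , x≤N) ∷ xs) N∉ =
  (1≤x , ≤-pred (≤∧≢⇒< x≤N (λ { refl → N∉ (here refl) }))) ∷ InRange-shrink xs (N∉ ∘ there)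

-- Bit lists are consumed from the largest value down; this removes the corresponding entry of a
-- peak list, at the price of reordering it.
extract-max : ∀ {N p} → Unique p → InRange (suc N) p → suc N ∈ p →
              ∃[ q ] p ↭ suc N ∷ q × suc N ∉ q × Unique q × InRange N q
extract-max {N} u r N∈p with ys , zs , refl ← ∈-∃++ N∈p
  with p↭ ← shift (suc N) ys zs
  with u′@(_ ∷ uq) ← Unique-resp-↭ (setoid ℕ) (↭⇒↭ₛ p↭) u
  with _ ∷ rq ← All-resp-↭ p↭ r
  = ys ++ zs , p↭ , Unique.Unique[x∷xs]⇒x∉xs u′ , uq , InRange-shrink rq (Unique.Unique[x∷xs]⇒x∉xs u′)

infix 4 _∈ᵇ_
_∈ᵇ_ : ℕ → List ℕ → Bool
j ∈ᵇ p = does (j ∈? p)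

agree : Bool → Bool → ℕ
agree true  true  = 1
agree true  false = 0
agree false true  = 0
agree false false = 1

-- Bit lists start with the largest value: the head of b ∷ bs is the bit of the value suc (length bs).
matches : List Bool → List ℕ → ℕ
matches []       p = 1
matches (b ∷ bs) p = agree b (suc (length bs) ∈ᵇ p) * matches bs p

matches-cong : ∀ bs {p q} → (∀ j → 1 ≤ j → j ≤ length bs → (j ∈ᵇ p) ≡ (j ∈ᵇ q)) →
               matches bs p ≡ matches bs q
matches-cong []       p≗q = refl
matches-cong (b ∷ bs) p≗q =
  cong₂ _*_ (cong (agree b) (p≗q _ (s≤s z≤n) ≤-refl))
            (matches-cong bs (λ j 1≤j j≤ → p≗q j 1≤j (m≤n⇒m≤1+n j≤)))

matches-↭ : ∀ bs {p q} → p ↭ q → matches bs p ≡ matches bs q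
matches-↭ bs {p} {q} p↭q = matches-cong bs (λ j _ _ →
  does-⇔ (mk⇔ (∈-resp-↭ p↭q) (∈-resp-↭ (↭-sym p↭q))) (j ∈? p) (j ∈? q))

matches-∷-max : ∀ b bs p → matches (b ∷ bs) (suc (length bs) ∷ p) ≡ agree b true * matches bs p
matches-∷-max b bs p = cong₂ _*_
  (cong (agree b) (dec-true (suc (length bs) ∈? suc (length bs) ∷ p) (here refl)))
  (matches-cong bs (λ j _ j≤ → does-⇔
    (mk⇔ (λ { (here refl) → contradiction j≤ (<⇒≱ ≤-refl) ; (there j∈) → j∈ }) there)
    (j ∈? suc (length bs) ∷ p) (j ∈? p)))

matches-∉ : ∀ b bs {p} → suc (length bs) ∉ p → matches (b ∷ bs) p ≡ agree b false * matches bs p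
matches-∉ b bs {p} N∉p = cong (λ z → agree b z * matches bs p) (dec-false (suc (length bs) ∈? p) N∉p)

matches-∈ : ∀ b bs {p q} → p ↭ suc (length bs) ∷ q →
            matches (b ∷ bs) p ≡ agree b true * matches bs q
matches-∈ b bs {p} {q} p↭ = trans (matches-↭ (b ∷ bs) p↭) (matches-∷-max b bs q)

dropSum : (List ℕ → ℕ) → List ℕ → ℕ
dropSum f []      = 0
dropSum f (x ∷ p) = f p + dropSum (f ∘ (x ∷_)) p

dropSum-cong : ∀ {f g} p → (∀ q → (∀ {x} → x ∈ q → x ∈ p) → f q ≡ g q) → dropSum f p ≡ dropSum g p
dropSum-cong []      f≗g = refl
dropSum-cong (x ∷ p) f≗g = cong₂ _+_ (f≗g p there)
  (dropSum-cong p (λ q q⊆p → f≗g (x ∷ q) λ { (here e) → here e ; (there y) → there (q⊆p y) }))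

dropSum-* : ∀ k f p → dropSum (λ q → k * f q) p ≡ k * dropSum f p
dropSum-* k f []      = sym (*-zeroʳ k)
dropSum-* k f (x ∷ p) = trans (cong (k * f p +_) (dropSum-* k (f ∘ (x ∷_)) p))
                                (sym (*-distribˡ-+ k (f p) _))

-- Peaks are listed by position and bits by value, so the functions summed over peak lists must not
-- see the order.
Symmetric : (List ℕ → ℕ) → Set
Symmetric f = ∀ {p q} → p ↭ q → f p ≡ f q

Symmetric-∷ : ∀ {f} x → Symmetric f → Symmetric (f ∘ (x ∷_))
Symmetric-∷ x f-sym p↭q = f-sym (prep x p↭q)

dropSum-↭ : ∀ {f p q} → Symmetric f → p ↭ q → dropSum f p ≡ dropSum f q
dropSum-↭ f-sym refl = refl
dropSum-↭ {f} f-sym (prep x p↭q) =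
  cong₂ _+_ (f-sym p↭q) (dropSum-↭ (Symmetric-∷ {f} x f-sym) p↭q)
dropSum-↭ {f} f-sym (swap {p} {q} x y p↭q) = begin
  f (y ∷ p) + (f (x ∷ p) + dropSum (λ r → f (x ∷ y ∷ r)) p)
    ≡⟨ cong₂ (λ a b → a + (b + dropSum (λ r → f (x ∷ y ∷ r)) p))
             (f-sym (prep y p↭q)) (f-sym (prep x p↭q)) ⟩
  f (y ∷ q) + (f (x ∷ q) + dropSum (λ r → f (x ∷ y ∷ r)) p)
    ≡⟨ cong (λ z → f (y ∷ q) + (f (x ∷ q) + z))
         (dropSum-↭ (Symmetric-∷ {f ∘ (x ∷_)} y (Symmetric-∷ {f} x f-sym)) p↭q) ⟩
  f (y ∷ q) + (f (x ∷ q) + dropSum (λ r → f (x ∷ y ∷ r)) q)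
    ≡⟨ cong (λ z → f (y ∷ q) + (f (x ∷ q) + z))
         (dropSum-cong q (λ r _ → f-sym (swap x y refl))) ⟩
  f (y ∷ q) + (f (x ∷ q) + dropSum (λ r → f (y ∷ x ∷ r)) q)
    ≡⟨ exchange (f (y ∷ q)) (f (x ∷ q)) _ ⟩
  f (x ∷ q) + (f (y ∷ q) + dropSum (λ r → f (y ∷ x ∷ r)) q) ∎
  where
  open ≡-Reasoning
  exchange : ∀ a b c → a + (b + c) ≡ b + (a + c)
  exchange = solve-∀
dropSum-↭ f-sym (_↭_.trans p↭q q↭r) = trans (dropSum-↭ f-sym p↭q) (dropSum-↭ f-sym q↭r)

upSum-agree : ∀ b p bs (a : ℕ) →
  (∀ d → length d ≡ length bs → matches (b ∷ d) p ≡ a * matches d p) →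
  upSum (λ d → matches (b ∷ d) p) bs ≡ a * upSum (λ d → matches d p) bs
upSum-agree b p bs a h = trans (upSum-cong bs h) (upSum-* a _ bs)

-- Double counting of the ways to destroy a peak: `p` without one entry has pattern `bs` exactly
-- when `p` has the pattern in which the bit of that entry is raised.
dropSum-matches : ∀ bs {p} → Unique p → InRange (length bs) p →
                  dropSum (matches bs) p ≡ upSum (λ d → matches d p) bs
dropSum-matches []       u []                  = refl
dropSum-matches []       u ((1≤x , x≤0) ∷ _) = contradiction (≤-trans 1≤x x≤0) λ ()
dropSum-matches (b ∷ bs) {p} u r with suc (length bs) ∈? p
... | no N∉p = begin
  dropSum (matches (b ∷ bs)) p
    ≡⟨ dropSum-cong p (λ q q⊆p → matches-∉ b bs (N∉p ∘ q⊆p)) ⟩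
  dropSum (λ q → agree b false * matches bs q) p
    ≡⟨ dropSum-* (agree b false) (matches bs) p ⟩
  agree b false * dropSum (matches bs) p
    ≡⟨ cong (agree b false *_) (dropSum-matches bs u (InRange-shrink r N∉p)) ⟩
  agree b false * upSum (λ d → matches d p) bs
    ≡⟨ close b ⟩
  upSum (λ d → matches d p) (b ∷ bs) ∎
  where
  open ≡-Reasoning
  absent : ∀ c d → length d ≡ length bs → matches (c ∷ d) p ≡ agree c false * matches d p
  absent c d e = matches-∉ c d (subst (λ n → suc n ∉ p) (sym e) N∉p)
  -- The top value is not in `p`, so patterns with a set head bit contribute 0.
  close : ∀ b → agree b false * upSum (λ d → matches d p) bs ≡ upSum (λ d → matches d p) (b ∷ bs)
  close true  = sym (upSum-agree true p bs 0 (absent true))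
  close false = sym (cong₂ _+_ (matches-∉ true bs N∉p) (upSum-agree false p bs 1 (absent false)))
... | yes N∈p with q , p↭ , N∉q , uq , rq ← extract-max u r N∈p = begin
  dropSum (matches (b ∷ bs)) p
    ≡⟨ dropSum-↭ (matches-↭ (b ∷ bs)) p↭ ⟩
  matches (b ∷ bs) q + dropSum (matches (b ∷ bs) ∘ (suc (length bs) ∷_)) q
    ≡⟨ cong₂ _+_ (matches-∉ b bs N∉q) (dropSum-cong q (λ ρ _ → matches-∷-max b bs ρ)) ⟩
  agree b false * matches bs q + dropSum (λ ρ → agree b true * matches bs ρ) q
    ≡⟨ cong (agree b false * matches bs q +_) (dropSum-* (agree b true) (matches bs) q) ⟩
  agree b false * matches bs q + agree b true * dropSum (matches bs) q
    ≡⟨ cong (λ z → agree b false * matches bs q + agree b true * z) (dropSum-matches bs uq rq) ⟩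
  agree b false * matches bs q + agree b true * upSum (λ d → matches d q) bs
    ≡⟨ close b ⟩
  upSum (λ d → matches d p) (b ∷ bs) ∎
  where
  open ≡-Reasoning
  present : ∀ c d → length d ≡ length bs → matches (c ∷ d) p ≡ agree c true * matches d q
  present c d e = matches-∈ c d (subst (λ n → p ↭ suc n ∷ q) (sym e) p↭)
  presentSum : ∀ c → upSum (λ d → matches (c ∷ d) p) bs ≡ agree c true * upSum (λ d → matches d q) bs
  presentSum c = trans (upSum-cong bs (present c)) (upSum-* (agree c true) _ bs)
  -- If `b` is `false`, the top value itself is the dropped entry, which gives the head term of
  -- `upSum`; if `b` is `true`, it stays and the drop happens in `q`.
  close : ∀ b → agree b false * matches bs q + agree b true * upSum (λ d → matches d q) bs ≡
                upSum (λ d → matches d p) (b ∷ bs)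
  close true  = sym (presentSum true)
  close false = sym (cong₂ _+_ (present true bs refl) (presentSum false))

-- A matching list without repetitions has one entry for each set bit. The factor `matches bs p` on
-- both sides takes care of the lists that do not match.
matches-length : ∀ bs {p} → Unique p → InRange (length bs) p →
                 length p * matches bs p ≡ ones bs * matches bs p
matches-length []       u []                  = refl
matches-length []       u ((1≤x , x≤0) ∷ _) = contradiction (≤-trans 1≤x x≤0) λ ()
matches-length (b ∷ bs) {p} u r = split (suc (length bs) ∈? p)
  where
  Goal : ℕ → ℕ → Set
  Goal l m = l * m ≡ ones (b ∷ bs) * m
  closeNo : ∀ b → length p * matches bs p ≡ ones bs * matches bs p →
            length p * (agree b false * matches bs p) ≡ ones (b ∷ bs) * (agree b false * matches bs p)
  closeNo true  _  = trans (*-zeroʳ (length p)) (sym (*-zeroʳ (ones bs)))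
  closeNo false IH = subst (λ z → length p * z ≡ ones bs * z) (sym (*-identityˡ _)) IH
  closeYes : ∀ b q → length q * matches bs q ≡ ones bs * matches bs q →
             suc (length q) * (agree b true * matches bs q) ≡ ones (b ∷ bs) * (agree b true * matches bs q)
  closeYes true  q IH = subst (λ z → z + length q * z ≡ z + ones bs * z) (sym (*-identityˡ _))
                              (cong (matches bs q +_) IH)
  closeYes false q _  = trans (*-zeroʳ (length q)) (sym (*-zeroʳ (ones bs)))
  split : Dec (suc (length bs) ∈ p) → Goal (length p) (matches (b ∷ bs) p)
  split (no N∉p) = subst (Goal (length p)) (sym (matches-∉ b bs N∉p))
    (closeNo b (matches-length bs u (InRange-shrink r N∉p)))
  split (yes N∈p) with q , p↭ , N∉q , uq , rq ← extract-max u r N∈p =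
    subst₂ Goal (sym (↭-length p↭)) (sym (matches-∈ b bs p↭)) (closeYes b q (matches-length bs uq rq))

-- Peaks after inserting a maximum

CP-peak : ∀ {a b c} r → a < b → c < b → CP (a ∷ b ∷ c ∷ r) ≡ b ∷ CP (b ∷ c ∷ r)
CP-peak {a} {b} {c} r a<b c<b rewrite dec-true (a <? b) a<b | dec-true (c <? b) c<b = refl

CP-left : ∀ {a b c} r → ¬ a < b → CP (a ∷ b ∷ c ∷ r) ≡ CP (b ∷ c ∷ r)
CP-left {a} {b} {c} r a≮b rewrite dec-false (a <? b) a≮b = refl

CP-right : ∀ {a b c} r → ¬ c < b → CP (a ∷ b ∷ c ∷ r) ≡ CP (b ∷ c ∷ r)
CP-right {a} {b} {c} r c≮b with does (a <? b)
... | false = refl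
... | true rewrite dec-false (c <? b) c≮b = refl

CP-descent : ∀ {a b} r → b < a → CP (a ∷ b ∷ r) ≡ CP (b ∷ r)
CP-descent []      b<a = refl
CP-descent (c ∷ r) b<a = CP-left r (<⇒≯ b<a)

-- In front, `v` is an end letter and no peak; the former first letter becomes interior but lies
-- below `v`, so it is still no peak.
CP-∷-max : ∀ {v} xs → All (_< v) xs → CP (v ∷ xs) ≡ CP xs
CP-∷-max []      _         = refl
CP-∷-max (x ∷ r) (x<v ∷ _) = CP-descent r x<v

insertions : ℕ → List ℕ → List (List ℕ)
insertions v []       = [ [ v ] ]
insertions v (x ∷ xs) = (v ∷ x ∷ xs) ∷ map (x ∷_) (insertions v xs)

sumMap-∘ : ∀ {A B : Set} (f : B → ℕ) (g : A → B) xs → sum (map f (map g xs)) ≡ sum (map (f ∘ g) xs)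
sumMap-∘ f g xs = cong sum (sym (map-∘ xs))

-- Inserting v after a: next to a peak b the peak set loses b and gains v (two slots each, `dropSum`), in
-- the other inner slots it gains v, at the end it is unchanged; moved so that no subtraction occurs.
PeakCount : (List ℕ → ℕ) → ℕ → ℕ → List ℕ → Set
PeakCount f v a xs =
  sum (map (λ τ → f (CP (a ∷ τ))) (insertions v xs)) + (2 * length p + 1) * f (v ∷ p) ≡
  f p + suc (length xs) * f (v ∷ p) + 2 * dropSum (f ∘ (v ∷_)) p
  where p = CP (a ∷ xs)

private
  -- Only the slots right after `a` and right after `b` touch the neighbours of `b`; in every later
  -- slot the triple `a`, `b`, `c` survives, and with it the status of `b`.
  sum-split : ∀ f v a b c r → All (_< v) (a ∷ b ∷ c ∷ r) →
    sum (map (λ τ → f (CP (a ∷ τ))) (insertions v (b ∷ c ∷ r))) ≡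
    f (v ∷ CP (b ∷ c ∷ r)) + (f (v ∷ CP (c ∷ r)) +
      sum (map (λ τ → f (CP (a ∷ b ∷ c ∷ τ))) (insertions v r)))
  sum-split f v a b c r (a<v ∷ b<v ∷ <v@(c<v ∷ _)) = cong₂ _+_
    (cong f (trans (CP-peak (c ∷ r) a<v b<v) (cong (v ∷_) (CP-∷-max _ (b<v ∷ <v)))))
    (cong₂ _+_
      (cong f (trans (CP-right (c ∷ r) (<⇒≯ b<v))
                     (trans (CP-peak r b<v c<v) (cong (v ∷_) (CP-∷-max _ <v)))))
      (trans (cong sum (sym (map-∘ (map (c ∷_) (insertions v r)))))
             (sumMap-∘ _ (c ∷_) (insertions v r))))

  sum-split₁ : ∀ f v b c r → All (_< v) (b ∷ c ∷ r) →
    sum (map (λ τ → f (CP (b ∷ τ))) (insertions v (c ∷ r))) ≡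
    f (v ∷ CP (c ∷ r)) + sum (map (λ τ → f (CP (b ∷ c ∷ τ))) (insertions v r))
  sum-split₁ f v b c r (b<v ∷ <v@(c<v ∷ _)) = cong₂ _+_
    (cong f (trans (CP-peak r b<v c<v) (cong (v ∷_) (CP-∷-max _ <v))))
    (sumMap-∘ _ (c ∷_) (insertions v r))

  -- When `b` is no peak, prefixing `a` adds a single slot, in which `v` joins the peaks without
  -- destroying any.
  nonpeak-step : ∀ f v a b c r → All (_< v) (a ∷ b ∷ c ∷ r) →
    (∀ x → CP (a ∷ b ∷ c ∷ x) ≡ CP (b ∷ c ∷ x)) →
    PeakCount f v b (c ∷ r) → PeakCount f v a (b ∷ c ∷ r)
  nonpeak-step f v a b c r <v@(_ ∷ <v′) eq IH
    rewrite sum-split f v a b c r <v | eq r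
          | map-cong (λ τ → cong f (eq τ)) (insertions v r)
          | sym (sum-split₁ f v b c r <v′) =
    step (sum (map (λ τ → f (CP (b ∷ τ))) (insertions v (c ∷ r)))) (f (v ∷ CP (b ∷ c ∷ r)))
      (length (CP (b ∷ c ∷ r))) (f (CP (b ∷ c ∷ r))) (length r)
      (dropSum (f ∘ (v ∷_)) (CP (b ∷ c ∷ r))) IH
    where
    shuffle : ∀ S F l → F + S + (2 * l + 1) * F ≡ F + (S + (2 * l + 1) * F)
    shuffle = solve-∀
    shuffle′ : ∀ e F n D → F + (e + suc (suc n) * F + 2 * D) ≡ e + suc (suc (suc n)) * F + 2 * D
    shuffle′ = solve-∀
    step : ∀ S F l e n D → S + (2 * l + 1) * F ≡ e + suc (suc n) * F + 2 * D →
           F + S + (2 * l + 1) * F ≡ e + suc (suc (suc n)) * F + 2 * D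
    step S F l e n D h = trans (shuffle S F l) (trans (cong (F +_) h) (shuffle′ e F n D))

  -- In both slots beside the peak `b` it is replaced by `v`; in the later ones `b` persists, so the
  -- tail is counted with `f ∘ (b ∷_)`. Symmetry of `f` brings `v` back to the front.
  peak-step : ∀ f v a b c r → Symmetric f → All (_< v) (a ∷ b ∷ c ∷ r) → a < b → c < b →
    PeakCount (f ∘ (b ∷_)) v b (c ∷ r) → PeakCount f v a (b ∷ c ∷ r)
  peak-step f v a b c r f-sym <v@(_ ∷ <v′) a<b c<b IH
    rewrite sum-split f v a b c r <v | CP-peak r a<b c<b
          | map-cong (λ τ → cong f (CP-peak τ a<b c<b)) (insertions v r)
          | sum-split₁ (f ∘ (b ∷_)) v b c r <v′
          | CP-descent r c<b
          | dropSum-cong {λ x → f (b ∷ v ∷ x)} {λ x → f (v ∷ b ∷ x)} (CP (c ∷ r))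
              (λ q _ → f-sym (swap b v refl))
          | f-sym (swap b v (refl {xs = CP (c ∷ r)})) =
    step (sum (map (λ τ → f (b ∷ CP (b ∷ c ∷ τ))) (insertions v r))) (f (v ∷ b ∷ CP (c ∷ r)))
      (f (v ∷ CP (c ∷ r))) (f (b ∷ CP (c ∷ r)))
      (length (CP (c ∷ r))) (length r) (dropSum (λ x → f (v ∷ b ∷ x)) (CP (c ∷ r))) IH
    where
    shuffle : ∀ S F G l → G + (G + S) + (2 * suc l + 1) * F ≡ F + 2 * G + (F + S + (2 * l + 1) * F)
    shuffle = solve-∀
    shuffle′ : ∀ e F G n D → F + 2 * G + (e + suc (suc n) * F + 2 * D) ≡
                             e + suc (suc (suc n)) * F + 2 * (G + D)
    shuffle′ = solve-∀
    step : ∀ S F G e l n D → F + S + (2 * l + 1) * F ≡ e + suc (suc n) * F + 2 * D →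
           G + (G + S) + (2 * suc l + 1) * F ≡ e + suc (suc (suc n)) * F + 2 * (G + D)
    -- The tail counts its slot after `b` as keeping `b`. That `F` and one more make up the two by
    -- which the new peak enlarges the correction term, and `2 * G` supplies the slots beside `b`.
    step S F G e l n D h =
      trans (shuffle S F G l) (trans (cong (F + 2 * G +_) h) (shuffle′ e F G n D))

peak-count : ∀ f v a xs → Symmetric f → All (_< v) (a ∷ xs) → PeakCount f v a xs
peak-count f v a []           f-sym _ = base (f []) (f [ v ])
  where
  base : ∀ e F → e + 0 + (2 * 0 + 1) * F ≡ e + 1 * F + 2 * 0
  base = solve-∀
peak-count f v a (b ∷ [])     f-sym (a<v ∷ b<v ∷ [])
  rewrite CP-peak [] a<v b<v | CP-right {a} {b} {v} [] (<⇒≯ b<v) = base (f []) (f [ v ])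
  where
  base : ∀ e F → F + (e + 0) + (2 * 0 + 1) * F ≡ e + 2 * F + 2 * 0
  base = solve-∀
peak-count f v a (b ∷ c ∷ r)  f-sym <v@(_ ∷ <v′) with a <? b | c <? b
... | yes a<b | yes c<b = peak-step f v a b c r f-sym <v a<b c<b
                            (peak-count (f ∘ (b ∷_)) v b (c ∷ r) (Symmetric-∷ {f} b f-sym) <v′)
... | no  a≮b | _       = nonpeak-step f v a b c r <v (λ x → CP-left x a≮b) (peak-count f v b (c ∷ r) f-sym <v′)
... | yes _   | no c≮b  = nonpeak-step f v a b c r <v (λ x → CP-right x c≮b) (peak-count f v b (c ∷ r) f-sym <v′)

-- Sums over lists

module _ {A : Set} where

  sumMap-cong : ∀ {f g : A → ℕ} xs → (∀ {x} → x ∈ xs → f x ≡ g x) → sum (map f xs) ≡ sum (map g xs)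
  sumMap-cong []       f≗g = refl
  sumMap-cong (x ∷ xs) f≗g = cong₂ _+_ (f≗g (here refl)) (sumMap-cong xs (f≗g ∘ there))

  sumMap-+ : ∀ (f g : A → ℕ) xs → sum (map (λ x → f x + g x) xs) ≡ sum (map f xs) + sum (map g xs)
  sumMap-+ f g []       = refl
  sumMap-+ f g (x ∷ xs) = trans (cong (f x + g x +_) (sumMap-+ f g xs)) (interchange (f x) (g x) _ _)
    where
    interchange : ∀ a b c d → a + b + (c + d) ≡ a + c + (b + d)
    interchange = solve-∀

  sumMap-* : ∀ k (f : A → ℕ) xs → sum (map (λ x → k * f x) xs) ≡ k * sum (map f xs)
  sumMap-* k f []       = sym (*-zeroʳ k)
  sumMap-* k f (x ∷ xs) = trans (cong (k * f x +_) (sumMap-* k f xs)) (sym (*-distribˡ-+ k (f x) _))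

  sumMap-upSum : ∀ (m : List Bool → A → ℕ) bs xs →
    sum (map (λ x → upSum (λ d → m d x) bs) xs) ≡ upSum (λ d → sum (map (m d) xs)) bs
  sumMap-upSum m bs []       = sym (upSum-0 bs)
  sumMap-upSum m bs (x ∷ xs) = trans (cong (upSum (λ d → m d x) bs +_) (sumMap-upSum m bs xs))
                                       (sym (upSum-+ _ _ bs))

  sum-concatMap : ∀ {B : Set} (f : B → ℕ) (g : A → List B) xs →
    sum (map f (concatMap g xs)) ≡ sum (map (λ x → sum (map f (g x))) xs)
  sum-concatMap f g []       = refl
  sum-concatMap f g (x ∷ xs) = begin
    sum (map f (g x ++ concatMap g xs))          ≡⟨ cong sum (map-++ f (g x) _) ⟩
    sum (map f (g x) ++ map f (concatMap g xs))  ≡⟨ sum-++ (map f (g x)) _ ⟩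
    sum (map f (g x)) + sum (map f (concatMap g xs))
      ≡⟨ cong (sum (map f (g x)) +_) (sum-concatMap f g xs) ⟩
    sum (map f (g x)) + sum (map (λ x → sum (map f (g x))) xs) ∎
    where open ≡-Reasoning

-- Generating permutations by insertion

PermOf : ℕ → List ℕ → Set
PermOf N σ = length σ ≡ N × InRange N σ × Unique σ

PermOf-resp-↭ : ∀ {N σ τ} → σ ↭ τ → PermOf N σ → PermOf N τ
PermOf-resp-↭ σ↭τ (l , r , u) =
  trans (sym (↭-length σ↭τ)) l , All-resp-↭ σ↭τ r , Unique-resp-↭ (setoid ℕ) (↭⇒↭ₛ σ↭τ) u

max∉ : ∀ {N σ} → InRange N σ → suc N ∉ σ
max∉ ((_ , N<N) ∷ _) (here refl) = <⇒≱ N<N ≤-refl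
max∉ (_ ∷ r)         (there N∈)  = max∉ r N∈

PermOf-∷-max : ∀ {N σ} → PermOf N σ → PermOf (suc N) (suc N ∷ σ)
PermOf-∷-max (l , r , u) =
  cong suc l , ((s≤s z≤n , ≤-refl) ∷ All.map (λ (a , b) → a , m≤n⇒m≤1+n b) r) ,
  (All.tabulate (λ { x∈ refl → max∉ r x∈ }) ∷ u)

insertion-↭ : ∀ {v} σ {τ} → τ ∈ insertions v σ → τ ↭ v ∷ σ
insertion-↭ []      (here refl) = refl
insertion-↭ (x ∷ σ) (here refl) = refl
insertion-↭ (x ∷ σ) (there τ∈) with ρ , ρ∈ , refl ← ∈-map⁻ (x ∷_) τ∈ =
  _↭_.trans (prep x (insertion-↭ σ ρ∈)) (swap x _ refl)

∈-insertions : ∀ v ys zs → ys ++ v ∷ zs ∈ insertions v (ys ++ zs)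
∈-insertions v []       []       = here refl
∈-insertions v []       (z ∷ zs) = here refl
∈-insertions v (y ∷ ys) zs       = there (∈-map⁺ (y ∷_) (∈-insertions v ys zs))

delete : ℕ → List ℕ → List ℕ
delete v = filter (λ x → ¬? (x ≟ v))

delete-∉ : ∀ {v σ} → v ∉ σ → delete v σ ≡ σ
delete-∉ v∉ = filter-all _ (All.tabulate (λ { x∈ refl → v∉ x∈ }))

-- Deletion inverts insertion, so insertions of a new letter into different words never coincide.
delete-insertion : ∀ {v} σ {τ} → v ∉ σ → τ ∈ insertions v σ → delete v τ ≡ σ
delete-insertion {v} []      v∉ (here refl) = filter-reject (λ x → ¬? (x ≟ v)) (λ v≢v → v≢v refl)
delete-insertion {v} (x ∷ σ) v∉ (here refl) =
  trans (filter-reject (λ x → ¬? (x ≟ v)) (λ v≢v → v≢v refl)) (delete-∉ v∉)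
delete-insertion {v} (x ∷ σ) v∉ (there τ∈) with ρ , ρ∈ , refl ← ∈-map⁻ (x ∷_) τ∈ =
  trans (filter-accept (λ x → ¬? (x ≟ v)) (λ { refl → v∉ (here refl) }))
          (cong (x ∷_) (delete-insertion σ (v∉ ∘ there) ρ∈))

-- The first insertion begins with `v`, all others with `x`, which differs from `v`.
insertions-unique : ∀ {v} σ → v ∉ σ → Unique (insertions v σ)
insertions-unique []      _  = [] ∷ []
insertions-unique {v} (x ∷ σ) v∉ =
  All.tabulate (λ τ∈ e → distinct e (∈-map⁻ (x ∷_) τ∈)) ∷
  Unique.map⁺ ∷-injectiveʳ (insertions-unique σ (v∉ ∘ there))
  where
  distinct : ∀ {τ xss} → v ∷ x ∷ σ ≡ τ → ¬ (∃[ ρ ] ρ ∈ xss × τ ≡ x ∷ ρ)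
  distinct refl (_ , _ , e) = v∉ (here (∷-injectiveˡ e))

concatMap-unique : ∀ {A B : Set} (f : A → List B) xs → Unique xs →
  (∀ {x} → x ∈ xs → Unique (f x)) →
  (∀ {x y z} → x ∈ xs → y ∈ xs → z ∈ f x → z ∈ f y → x ≡ y) →
  Unique (concatMap f xs)
concatMap-unique f []       _              _  _  = []
concatMap-unique f (x ∷ xs) u@(_ ∷ uxs) uf inj =
  Unique.++⁺ (uf (here refl))
    (concatMap-unique f xs uxs (uf ∘ there) (λ x∈ y∈ → inj (there x∈) (there y∈)))
    disjoint
  where
  disjoint : ∀ {z} → ¬ (z ∈ f x × z ∈ concatMap f xs)
  disjoint (z∈fx , z∈) with y , y∈ , z∈fy ← find (∈-concatMap⁻ f {xs = xs} z∈)
    with refl ← inj (here refl) (there y∈) z∈fx z∈fy = Unique.Unique[x∷xs]⇒x∉xs u y∈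

insertionPerms : ℕ → List (List ℕ)
insertionPerms zero    = [ [] ]
insertionPerms (suc N) = concatMap (insertions (suc N)) (insertionPerms N)

insertionPerms-sound : ∀ N {σ} → σ ∈ insertionPerms N → PermOf N σ
insertionPerms-sound zero    (here refl) = refl , [] , []
insertionPerms-sound (suc N) σ∈
  with ρ , ρ∈ , σ∈ins ← find (∈-concatMap⁻ (insertions (suc N)) {xs = insertionPerms N} σ∈) =
  PermOf-resp-↭ (↭-sym (insertion-↭ ρ σ∈ins)) (PermOf-∷-max (insertionPerms-sound N ρ∈))

insertionPerms-unique : ∀ N → Unique (insertionPerms N)
insertionPerms-unique zero    = [] ∷ []
insertionPerms-unique (suc N) = concatMap-unique (insertions (suc N)) (insertionPerms N)
  (insertionPerms-unique N)
  (λ {σ} σ∈ → insertions-unique σ (fresh σ∈))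
  (λ {σ} {τ} σ∈ τ∈ z∈σ z∈τ →
    trans (sym (delete-insertion σ (fresh σ∈) z∈σ)) (delete-insertion τ (fresh τ∈) z∈τ))
  where
  fresh : ∀ {σ} → σ ∈ insertionPerms N → suc N ∉ σ
  fresh σ∈ = max∉ (proj₁ (proj₂ (insertionPerms-sound N σ∈)))

-- Pigeonhole principle, by peeling off the top value if it occurs. It forces a word of length
-- `suc N` to contain `suc N` in `insertionPerms-complete`.
length-bound : ∀ N {σ} → Unique σ → InRange N σ → length σ ≤ N
length-bound zero    u []                  = z≤n
length-bound zero    u ((1≤x , x≤0) ∷ _) = contradiction (≤-trans 1≤x x≤0) λ ()
length-bound (suc N) {σ} u r with suc N ∈? σ
... | no  N∉ = m≤n⇒m≤1+n (length-bound N u (InRange-shrink r N∉))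
... | yes N∈ with q , σ↭ , _ , uq , rq ← extract-max u r N∈ =
  subst (_≤ suc N) (sym (↭-length σ↭)) (s≤s (length-bound N uq rq))

insertionPerms-complete : ∀ N {σ} → PermOf N σ → σ ∈ insertionPerms N
insertionPerms-complete zero    {[]} _ = here refl
insertionPerms-complete (suc N) {σ} perm@(l , r , u) with suc N ∈? σ
... | no  N∉ = contradiction (subst (_≤ N) l (length-bound N u (InRange-shrink r N∉))) (<⇒≱ ≤-refl)
... | yes N∈ with ys , zs , refl ← ∈-∃++ N∈
  with l′ , _ ∷ r′ , u′@(_ ∷ u″) ← PermOf-resp-↭ (shift (suc N) ys zs) perm =
  ∈-concatMap⁺ (insertions (suc N)) (lose
    (insertionPerms-complete N
      (suc-injective l′ , InRange-shrink r′ (Unique.Unique[x∷xs]⇒x∉xs u′) , u″))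
    (∈-insertions (suc N) ys zs))

-- Intervals, words and the enumeration `perms`

∈-interval⁺ : ∀ {a b x} → a ≤ x → x ≤ b → x ∈ interval a b
∈-interval⁺ {a} {b} {x} a≤x x≤b = subst (_∈ interval a b) (m+[n∸m]≡n a≤x)
  (∈-map⁺ (a +_) (∈-upTo⁺ (∸-monoˡ-< (s≤s x≤b) a≤x)))

∈-interval⁻ : ∀ {a b x} → x ∈ interval a b → a ≤ x × x ≤ b
∈-interval⁻ {a} {b} x∈ with i , i∈ , refl ← ∈-map⁻ (a +_) x∈ =
  m≤m+n a i , ≤-pred (subst (suc (a + i) ≤_) (m+[n∸m]≡n a≤1+b)
    (subst (_≤ a + (suc b ∸ a)) (+-suc a i) (+-monoʳ-≤ a (∈-upTo⁻ i∈))))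
  where
  a≤1+b : a ≤ suc b
  -- The interval has an element, so its length `suc b ∸ a` is nonzero and the subtraction is not
  -- truncated.
  a≤1+b = <⇒≤ (m∸n≢0⇒n<m (λ e → <⇒≱ (≤-trans (s≤s z≤n) (∈-upTo⁻ i∈)) (≤-reflexive e)))

words-sound : ∀ l A {σ} → σ ∈ words l A → length σ ≡ l × All (_∈ A) σ
words-sound zero    A (here refl) = refl , []
words-sound (suc l) A σ∈
  with a , a∈ , σ∈a ← find (∈-concatMap⁻ (λ a → map (a ∷_) (words l A)) {xs = A} σ∈)
  with ρ , ρ∈ , refl ← ∈-map⁻ (a ∷_) σ∈a
  with len , all ← words-sound l A ρ∈ = cong suc len , a∈ ∷ all

words-complete : ∀ {A σ} → All (_∈ A) σ → σ ∈ words (length σ) A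
words-complete []        = here refl
words-complete {A} {a ∷ σ} (a∈ ∷ all) =
  ∈-concatMap⁺ (λ a → map (a ∷_) (words (length σ) A))
    (lose a∈ (∈-map⁺ (a ∷_) (words-complete all)))

words-unique : ∀ l {A} → Unique A → Unique (words l A)
words-unique zero        u = [] ∷ []
words-unique (suc l) {A} u = concatMap-unique (λ a → map (a ∷_) (words l A)) A u
  (λ _ → Unique.map⁺ ∷-injectiveʳ (words-unique l u))
  (λ {x} {y} _ _ z∈x z∈y → same-head (∈-map⁻ (x ∷_) z∈x) (∈-map⁻ (y ∷_) z∈y))
  where
  same-head : ∀ {x y : ℕ} {z xss yss} → (∃[ ρ ] ρ ∈ xss × z ≡ x ∷ ρ) →
              (∃[ ρ ] ρ ∈ yss × z ≡ y ∷ ρ) → x ≡ y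
  same-head (_ , _ , refl) (_ , _ , e) = ∷-injectiveˡ e

-- Two lists without repetitions and with the same elements are rearrangements of each other. Sums
-- over `perms` may therefore follow the recursive enumeration.
perms-↭ : ∀ N → perms N ↭ insertionPerms N
perms-↭ N = ∼bag⇒↭ (unique∧set⇒bag
  (Unique.filter⁺ unique? (words-unique N (Unique.map⁺ suc-injective (Unique.upTo⁺ N))))
  (insertionPerms-unique N)
  (mk⇔ to from))
  where
  to : ∀ {σ} → σ ∈ perms N → σ ∈ insertionPerms N
  to σ∈ with σ∈words , u ← ∈-filter⁻ unique? {xs = words N (interval 1 N)} σ∈
    with l , all ← words-sound N _ σ∈words =
    insertionPerms-complete N (l , All.map ∈-interval⁻ all , u)
  from : ∀ {σ} → σ ∈ insertionPerms N → σ ∈ perms N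
  from σ∈ with l , r , u ← insertionPerms-sound N σ∈ =
    ∈-filter⁺ unique? (subst (λ n → _ ∈ words n (interval 1 N)) l
      (words-complete (All.map (λ (1≤x , x≤N) → ∈-interval⁺ 1≤x x≤N) r))) u

-- The insertion recursion for numbers of peak sets

-- An end letter is never a peak, so nothing is asked of `a`. `CP-Unique` relies on this when `P`
-- says that an entry differs from the first letter.
CP-All : ∀ {P : ℕ → Set} a {xs} → All P xs → All P (CP (a ∷ xs))
CP-All a []       = []
CP-All a (_ ∷ []) = []
CP-All {P} a {b ∷ c ∷ r} (pb ∷ ps@(_ ∷ _)) = extend (does (a <? b) ∧ does (c <? b)) (CP-All b ps)
  where
  extend : ∀ t {xs} → All P xs → All P ((if t then (b ∷_) else (λ xs → xs)) xs)
  extend true  ps = pb ∷ ps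
  extend false ps = ps

CP-Unique : ∀ {σ} → Unique σ → Unique (CP σ)
CP-Unique []              = []
CP-Unique (_ ∷ [])        = []
CP-Unique (_ ∷ _ ∷ [])    = []
CP-Unique {a ∷ b ∷ c ∷ r} (_ ∷ u@(b≢ ∷ _ ∷ _)) =
  extend (does (a <? b) ∧ does (c <? b)) (CP-All b b≢) (CP-Unique u)
  where
  extend : ∀ t {xs} → All (b ≢_) xs → Unique xs → Unique ((if t then (b ∷_) else (λ xs → xs)) xs)
  extend true  b≢ u = b≢ ∷ u
  extend false b≢ u = u

CP-InRange : ∀ {N σ} → InRange N σ → InRange N (CP σ)
CP-InRange []      = []
CP-InRange {σ = a ∷ _} (_ ∷ r) = CP-All a r

-- The slot in front of `a` joins the slot at the far end as the second one that changes no peak,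
-- hence `2 * f (CP σ)`.
peak-count-all : ∀ f v σ → σ ≢ [] → Symmetric f → All (_< v) σ →
  sum (map (f ∘ CP) (insertions v σ)) + (2 * length (CP σ) + 1) * f (v ∷ CP σ) ≡
  2 * f (CP σ) + length σ * f (v ∷ CP σ) + 2 * dropSum (f ∘ (v ∷_)) (CP σ)
peak-count-all f v []       σ≢[] _     _  = contradiction refl σ≢[]
peak-count-all f v (a ∷ xs) _    f-sym <v = begin
  f (CP (v ∷ a ∷ xs)) + sum (map (f ∘ CP) (map (a ∷_) (insertions v xs))) + K
    ≡⟨ cong₂ (λ y z → y + z + K) (cong f (CP-∷-max (a ∷ xs) <v)) (sumMap-∘ (f ∘ CP) (a ∷_) (insertions v xs)) ⟩
  e + S + K                       ≡⟨ +-assoc e S K ⟩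
  e + (S + K)                     ≡⟨ cong (e +_) (peak-count f v a xs f-sym <v) ⟩
  e + (e + L * F + 2 * D)         ≡⟨ regroup e (L * F) D ⟩
  2 * e + L * F + 2 * D           ∎
  where
  open ≡-Reasoning
  e = f (CP (a ∷ xs))
  F = f (v ∷ CP (a ∷ xs))
  K = (2 * length (CP (a ∷ xs)) + 1) * F
  S = sum (map (λ τ → f (CP (a ∷ τ))) (insertions v xs))
  L = suc (length xs)
  D = dropSum (f ∘ (v ∷_)) (CP (a ∷ xs))
  regroup : ∀ e l D → e + (e + l + 2 * D) ≡ 2 * e + l + 2 * D
  regroup = solve-∀

peakSets : ℕ → List Bool → ℕ
peakSets N bs = sum (map (matches bs ∘ CP) (insertionPerms N))

-- A cleared head bit rules out all slots in which `suc n` becomes a peak, so only the two ends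
-- remain.
insert-nonpeak : ∀ {n σ} bs → length bs ≡ n → σ ≢ [] → PermOf n σ →
  sum (map (matches (false ∷ bs) ∘ CP) (insertions (suc n) σ)) ≡ 2 * matches bs (CP σ)
insert-nonpeak {n} {σ} bs refl σ≢[] (l , r , u) = begin
  S                                         ≡⟨ +-identityʳ S ⟨
  S + 0                                     ≡⟨ cong (S +_) (*-zeroʳ (2 * length p + 1)) ⟨
  S + (2 * length p + 1) * 0                ≡⟨ cong (λ z → S + (2 * length p + 1) * z) (matches-∷-max false bs p) ⟨
  S + (2 * length p + 1) * f (v ∷ p) ≡⟨ peak-count-all f v σ σ≢[] (matches-↭ (false ∷ bs)) <v ⟩
  2 * f p + length σ * f (v ∷ p) + 2 * dropSum (f ∘ (v ∷_)) p
    ≡⟨ cong₂ (λ y z → 2 * f p + length σ * y + 2 * z) (matches-∷-max false bs p)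
         (trans (dropSum-cong p (λ q _ → matches-∷-max false bs q)) (dropSum-* 0 (matches bs) p)) ⟩
  2 * f p + length σ * 0 + 0
    ≡⟨ cong₂ (λ y z → 2 * y + z + 0) (trans (matches-∉ false bs v∉CP) (*-identityˡ _)) (*-zeroʳ (length σ)) ⟩
  2 * matches bs p + 0 + 0                  ≡⟨ trans (+-identityʳ _) (+-identityʳ _) ⟩
  2 * matches bs p                          ∎
  where
  open ≡-Reasoning
  v = suc n
  <v : All (_< v) σ
  <v = All.map (s≤s ∘ proj₂) r
  v∉CP : v ∉ CP σ
  v∉CP = max∉ (CP-InRange r)
  p = CP σ
  f = matches (false ∷ bs)
  S = sum (map (f ∘ CP) (insertions v σ))

-- A set head bit rules out the two ends. Replacing the number of peaks by `ones bs` and `dropSum`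
-- by `upSum` leaves coefficients that do not depend on `σ`, so the identity can be summed over all
-- `σ`.
insert-peak : ∀ {n σ} bs → length bs ≡ n → σ ≢ [] → PermOf n σ →
  sum (map (matches (true ∷ bs) ∘ CP) (insertions (suc n) σ)) +
    (2 * ones bs + 1) * matches bs (CP σ) ≡
  n * matches bs (CP σ) + 2 * upSum (λ d → matches d (CP σ)) bs
insert-peak {n} {σ} bs refl σ≢[] (l , r , u) = begin
  S + (2 * ones bs + 1) * m ≡⟨ cong (S +_) (distrib (ones bs) m) ⟩
  S + (2 * (ones bs * m) + m) ≡⟨ cong (λ z → S + (2 * z + m)) (matches-length bs (CP-Unique u) (CP-InRange r)) ⟨
  S + (2 * (length p * m) + m) ≡⟨ cong (S +_) (distrib (length p) m) ⟨
  S + (2 * length p + 1) * m ≡⟨ cong (λ z → S + (2 * length p + 1) * z) f-max ⟨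
  S + (2 * length p + 1) * f (v ∷ p) ≡⟨ peak-count-all f v σ σ≢[] (matches-↭ (true ∷ bs)) <v ⟩
  2 * f p + length σ * f (v ∷ p) + 2 * dropSum (f ∘ (v ∷_)) p
    ≡⟨ cong₂ (λ y z → 2 * y + z + 2 * dropSum (f ∘ (v ∷_)) p) (matches-∉ true bs v∉CP)
             (cong₂ _*_ l f-max) ⟩
  n * m + 2 * dropSum (f ∘ (v ∷_)) p
    ≡⟨ cong (λ z → n * m + 2 * z)
         (trans (dropSum-cong p (λ q _ → trans (matches-∷-max true bs q) (*-identityˡ _)))
                (dropSum-matches bs (CP-Unique u) (CP-InRange r))) ⟩
  n * m + 2 * upSum (λ d → matches d p) bs ∎
  where
  open ≡-Reasoning
  v = suc n
  <v : All (_< v) σ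
  <v = All.map (s≤s ∘ proj₂) r
  v∉CP : v ∉ CP σ
  v∉CP = max∉ (CP-InRange r)
  p = CP σ
  m = matches bs p
  f = matches (true ∷ bs)
  S = sum (map (f ∘ CP) (insertions v σ))
  f-max : f (v ∷ p) ≡ m
  f-max = trans (matches-∷-max true bs p) (*-identityˡ m)
  distrib : ∀ l m → (2 * l + 1) * m ≡ 2 * (l * m) + m
  distrib = solve-∀

insertionPerms-nonempty : ∀ N {σ} → σ ∈ insertionPerms (suc N) → σ ≢ []
insertionPerms-nonempty N σ∈ refl with () ← proj₁ (insertionPerms-sound (suc N) σ∈)

transfer-0 : ∀ b bs → transfer (b ∷ bs) 0 ≡ 0
transfer-0 true  bs = refl
transfer-0 false bs = refl

-- A finished permutation is one block, hence state 1. For `false` the term at state 0 vanishes,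
-- since letters remain and no block may. For `true` the destroying slots are added on both sides,
-- `cut-identity bs 1` is applied and they are cancelled; the hypothesis is used at all raised
-- lists, so `bs` stays general.
peakSets-transfer : ∀ N bs → length bs ≡ suc N → peakSets (suc N) bs ≡ transfer bs 1
peakSets-transfer zero    (true  ∷ []) _ = refl
peakSets-transfer zero    (false ∷ []) _ = refl
peakSets-transfer (suc N) (false ∷ bs@(b ∷ bs′)) e = begin
  peakSets (suc (suc N)) (false ∷ bs)
    ≡⟨ sum-concatMap _ (insertions (suc (suc N))) (insertionPerms (suc N)) ⟩
  sum (map (λ σ → sum (map (matches (false ∷ bs) ∘ CP) (insertions (suc (suc N)) σ))) (insertionPerms (suc N)))
    ≡⟨ sumMap-cong (insertionPerms (suc N)) (λ σ∈ →
         insert-nonpeak bs (suc-injective e) (insertionPerms-nonempty N σ∈) (insertionPerms-sound (suc N) σ∈)) ⟩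
  sum (map (λ σ → 2 * matches bs (CP σ)) (insertionPerms (suc N)))
    ≡⟨ sumMap-* 2 _ (insertionPerms (suc N)) ⟩
  2 * peakSets (suc N) bs
    ≡⟨ cong (2 *_) (peakSets-transfer N bs (suc-injective e)) ⟩
  2 * transfer bs 1
    ≡⟨ cong (_+ 2 * transfer bs 1) (transfer-0 b bs′) ⟨
  transfer bs 0 + 2 * transfer bs 1
    ≡⟨ *-identityˡ _ ⟨
  1 * (transfer bs 0 + 2 * transfer bs 1) ∎
  where open ≡-Reasoning
peakSets-transfer (suc N) (true ∷ bs) e = +-cancelʳ-≡ ((2 * ones bs + 1) * transfer bs 1) _ _ (begin
  peakSets (suc (suc N)) (true ∷ bs) + (2 * ones bs + 1) * transfer bs 1
    ≡⟨ cong₂ (λ y z → y + (2 * ones bs + 1) * z)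
         (sum-concatMap _ (insertions (suc (suc N))) (insertionPerms (suc N)))
         (sym (peakSets-transfer N bs (suc-injective e))) ⟩
  sum (map S (insertionPerms (suc N))) + (2 * ones bs + 1) * peakSets (suc N) bs
    ≡⟨ cong (sum (map S (insertionPerms (suc N))) +_) (sumMap-* (2 * ones bs + 1) _ (insertionPerms (suc N))) ⟨
  sum (map S (insertionPerms (suc N))) +
    sum (map (λ σ → (2 * ones bs + 1) * matches bs (CP σ)) (insertionPerms (suc N)))
    ≡⟨ sumMap-+ S _ (insertionPerms (suc N)) ⟨
  sum (map (λ σ → S σ + (2 * ones bs + 1) * matches bs (CP σ)) (insertionPerms (suc N)))
    ≡⟨ sumMap-cong (insertionPerms (suc N)) (λ σ∈ →
         insert-peak bs (suc-injective e) (insertionPerms-nonempty N σ∈) (insertionPerms-sound (suc N) σ∈)) ⟩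
  sum (map (λ σ → suc N * matches bs (CP σ) + 2 * upSum (λ d → matches d (CP σ)) bs) (insertionPerms (suc N)))
    ≡⟨ sumMap-+ _ _ (insertionPerms (suc N)) ⟩
  sum (map (λ σ → suc N * matches bs (CP σ)) (insertionPerms (suc N))) +
    sum (map (λ σ → 2 * upSum (λ d → matches d (CP σ)) bs) (insertionPerms (suc N)))
    ≡⟨ cong₂ _+_ (sumMap-* (suc N) _ (insertionPerms (suc N)))
         (trans (sumMap-* 2 _ (insertionPerms (suc N)))
                (cong (2 *_) (sumMap-upSum (λ d σ → matches d (CP σ)) bs (insertionPerms (suc N))))) ⟩
  suc N * peakSets (suc N) bs + 2 * upSum (peakSets (suc N)) bs
    ≡⟨ cong₂ (λ y z → suc N * y + 2 * z) (peakSets-transfer N bs (suc-injective e))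
         (upSum-cong bs (λ d l → peakSets-transfer N d (trans l (suc-injective e)))) ⟩
  suc N * transfer bs 1 + 2 * upSum (λ d → transfer d 1) bs
    ≡⟨ cong (λ n → n * transfer bs 1 + 2 * upSum (λ d → transfer d 1) bs) (suc-injective e) ⟨
  length bs * transfer bs 1 + 2 * upSum (λ d → transfer d 1) bs
    ≡⟨ cut-identity bs 1 ⟨
  1 * transfer bs 2 + (1 + 2 * ones bs) * transfer bs 1
    ≡⟨ cong (λ z → 1 * transfer bs 2 + z * transfer bs 1) (+-comm 1 (2 * ones bs)) ⟩
  1 * transfer bs 2 + (2 * ones bs + 1) * transfer bs 1 ∎)
  where
  open ≡-Reasoning
  S : List ℕ → ℕ
  S σ = sum (map (matches (true ∷ bs) ∘ CP) (insertions (suc (suc N)) σ))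

-- From bit patterns to `cp`

bitsOf : ℕ → List ℕ → List Bool
bitsOf zero    T = []
bitsOf (suc N) T = (suc N ∈ᵇ T) ∷ bitsOf N T

length-bitsOf : ∀ N T → length (bitsOf N T) ≡ N
length-bitsOf zero    T = refl
length-bitsOf (suc N) T = cong suc (length-bitsOf N T)

agree-refl : ∀ b → agree b b ≡ 1
agree-refl true  = refl
agree-refl false = refl

agree-≢0 : ∀ b c {m} → agree b c * m ≢ 0 → b ≡ c
agree-≢0 true  true  _  = refl
agree-≢0 true  false ≢0 = contradiction refl ≢0
agree-≢0 false true  ≢0 = contradiction refl ≢0
agree-≢0 false false _  = refl

SameUpTo : ℕ → List ℕ → List ℕ → Set
SameUpTo N p q = ∀ j → 1 ≤ j → j ≤ N → (j ∈ᵇ p) ≡ (j ∈ᵇ q)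

matches-same : ∀ N T p → SameUpTo N T p → matches (bitsOf N T) p ≡ 1
matches-same zero    T p same = refl
matches-same (suc N) T p same rewrite length-bitsOf N T | same (suc N) (s≤s z≤n) ≤-refl =
  cong₂ _*_ (agree-refl (suc N ∈ᵇ p)) (matches-same N T p (λ j 1≤j j≤N → same j 1≤j (m≤n⇒m≤1+n j≤N)))

matches-≢0 : ∀ N T p → matches (bitsOf N T) p ≢ 0 → SameUpTo N T p
matches-≢0 zero    T p ≢0 j 1≤j j≤0 = contradiction (≤-trans 1≤j j≤0) λ ()
matches-≢0 (suc N) T p ≢0 j 1≤j j≤N rewrite length-bitsOf N T with m≤n⇒m<n∨m≡n j≤N
... | inj₁ (s≤s j≤N′) = matches-≢0 N T p
        (λ m≡0 → ≢0 (trans (cong (agree (suc N ∈ᵇ T) (suc N ∈ᵇ p) *_) m≡0)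
                            (*-zeroʳ (agree (suc N ∈ᵇ T) (suc N ∈ᵇ p)))))
        j 1≤j j≤N′
... | inj₂ refl = agree-≢0 _ _ ≢0

∈ᵇ⇒∈ : ∀ {j p q} → (j ∈ᵇ p) ≡ (j ∈ᵇ q) → j ∈ p → j ∈ q
∈ᵇ⇒∈ {j} {p} {q} e j∈p with j ∈? q
... | yes j∈q = j∈q
... | no  _   = contradiction (trans (sym (dec-true (j ∈? p) j∈p)) e) λ ()

count-filter : ∀ {A : Set} {P : A → Set} (P? : ∀ x → Dec (P x)) (g : A → ℕ) xs →
  (∀ {x} → x ∈ xs → P x → g x ≡ 1) → (∀ {x} → x ∈ xs → ¬ P x → g x ≡ 0) →
  length (filter P? xs) ≡ sum (map g xs)
count-filter P? g []       _   _   = refl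
count-filter P? g (x ∷ xs) g≡1 g≡0 with P? x
... | yes px = cong₂ _+_ (sym (g≡1 (here refl) px)) (count-filter P? g xs (g≡1 ∘ there) (g≡0 ∘ there))
... | no ¬px = trans (count-filter P? g xs (g≡1 ∘ there) (g≡0 ∘ there))
                     (cong (_+ sum (map g xs)) (sym (g≡0 (here refl) ¬px)))

-- For peak sets of permutations, `matches` is the indicator of `CPis T`: both sets lie in the range
-- from 1 to `suc N`, so agreement of the bits there is equality of sets.
cp-transfer : ∀ N T → InRange (suc N) T → cp (suc N) T ≡ transfer (bitsOf (suc N) T) 1
cp-transfer N T rT = begin
  cp (suc N) T
    ≡⟨ count-filter (CPis? T) (matches bits ∘ CP) (perms (suc N)) one zer ⟩
  sum (map (matches bits ∘ CP) (perms (suc N)))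
    ≡⟨ sum-↭ (map⁺ (matches bits ∘ CP) (perms-↭ (suc N))) ⟩
  peakSets (suc N) bits
    ≡⟨ peakSets-transfer N bits (length-bitsOf (suc N) T) ⟩
  transfer bits 1 ∎
  where
  open ≡-Reasoning
  bits = bitsOf (suc N) T
  range : ∀ {σ} → σ ∈ perms (suc N) → InRange (suc N) (CP σ)
  range σ∈ = CP-InRange (proj₁ (proj₂ (insertionPerms-sound (suc N) (∈-resp-↭ (perms-↭ (suc N)) σ∈))))
  one : ∀ {σ} → σ ∈ perms (suc N) → CPis T σ → matches bits (CP σ) ≡ 1
  one {σ} _ (CP⊆T , T⊆CP) =
    matches-same (suc N) T (CP σ) (λ j _ _ → does-⇔ (mk⇔ T⊆CP CP⊆T) (j ∈? T) (j ∈? CP σ))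
  same⇒CPis : ∀ {σ} → σ ∈ perms (suc N) → SameUpTo (suc N) T (CP σ) → CPis T σ
  same⇒CPis {σ} σ∈ same =
    (λ j∈ → let (1≤j , j≤N) = All.lookup (range σ∈) j∈ in ∈ᵇ⇒∈ {q = T} (sym (same _ 1≤j j≤N)) j∈) ,
    (λ j∈ → let (1≤j , j≤N) = All.lookup rT j∈ in ∈ᵇ⇒∈ {q = CP σ} (same _ 1≤j j≤N) j∈)
  zer : ∀ {σ} → σ ∈ perms (suc N) → ¬ CPis T σ → matches bits (CP σ) ≡ 0
  zer {σ} σ∈ ¬CPis with matches bits (CP σ) ≟ 0
  ... | yes e = e
  ... | no ≢0 = contradiction (same⇒CPis σ∈ (matches-≢0 (suc N) T (CP σ) ≢0)) ¬CPis

-- Circular-peak paths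

-- Each step, H or R, raises x - y by one, so every path from (r,0) to (N,k) has exactly N - r - k
-- steps, and its weights depend on i + y only. This is the total weight of `g` steps taking i + y
-- from `a` to `b`.
climb : ℕ → ℕ → ℕ → ℕ
climb zero    a b = if does (a ≟ b) then 1 else 0
climb (suc g) a b = 2 * suc a * climb g a b + suc a * suc (suc a) * climb g (suc a) b

climb-diag : ∀ a → climb 0 a a ≡ 1
climb-diag a rewrite dec-true (a ≟ a) refl = refl

climb-≢ : ∀ {a b} → a ≢ b → climb 0 a b ≡ 0
climb-≢ {a} {b} a≢b rewrite dec-false (a ≟ b) a≢b = refl

climb-> : ∀ g {a b} → b < a → climb g a b ≡ 0
climb-> zero        b<a = climb-≢ (≢-sym (<⇒≢ b<a))
climb-> (suc g) {a} b<a rewrite climb-> g b<a | climb-> g (m<n⇒m<1+n b<a) =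
  cong₂ _+_ (*-zeroʳ (2 * suc a)) (*-zeroʳ (suc a * suc (suc a)))

sum-map-filter : ∀ {A : Set} {P : A → Set} (P? : ∀ x → Dec (P x)) (f : A → ℕ) xs →
  sum (map f (filter P? xs)) ≡ sum (map (λ x → if does (P? x) then f x else 0) xs)
sum-map-filter P? f []       = refl
sum-map-filter P? f (x ∷ xs) with does (P? x)
... | true  = cong (f x +_) (sum-map-filter P? f xs)
... | false = sum-map-filter P? f xs

if-* : ∀ t a {b} → (if t then a * b else 0) ≡ a * (if t then b else 0)
if-* true  a = refl
if-* false a = sym (*-zeroʳ a)

module _ (i N k : ℕ) where

  endsAt? : (p : ℕ × ℕ) (P : List Step) → Dec (endpoint p P ≡ (N , k))
  endsAt? p P = ≡-dec _≟_ _≟_ (endpoint p P) (N , k)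

  contribution : ℕ × ℕ → List Step → ℕ
  contribution p P = if does (endsAt? p P) then weightFrom i p P else 0

  pathSum : ℕ → ℕ × ℕ → ℕ
  pathSum l p = sum (map (contribution p) (stepSeqs l))

  -- Split by the first step. The term of `[]` recurs at every stage because `stepSeqs l` lists all
  -- sequences of at most `l` steps.
  pathSum-suc : ∀ l x y → pathSum (suc l) (x , y) ≡
    contribution (x , y) [] + (2 * suc (i + y) * pathSum l (suc x , y) +
      suc (i + y) * suc (suc (i + y)) * pathSum l (x + 2 , suc y))
  pathSum-suc l x y = cong (contribution (x , y) [] +_) (begin
    sum (map (contribution (x , y)) (map (H ∷_) S ++ map (R ∷_) S ++ []))
      ≡⟨ cong (λ z → sum (map (contribution (x , y)) (map (H ∷_) S ++ z))) (++-identityʳ (map (R ∷_) S)) ⟩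
    sum (map (contribution (x , y)) (map (H ∷_) S ++ map (R ∷_) S))
      ≡⟨ cong sum (map-++ (contribution (x , y)) (map (H ∷_) S) _) ⟩
    sum (map (contribution (x , y)) (map (H ∷_) S) ++ map (contribution (x , y)) (map (R ∷_) S))
      ≡⟨ sum-++ (map (contribution (x , y)) (map (H ∷_) S)) _ ⟩
    sum (map (contribution (x , y)) (map (H ∷_) S)) + sum (map (contribution (x , y)) (map (R ∷_) S))
      ≡⟨ cong₂ _+_
           (first-step H (suc x , y) (2 * suc (i + y)) (λ P → trans
             (if-* (does (endsAt? (suc x , y) P)) (2 * i + 2 * (y + 1)))
             (cong (_* contribution (suc x , y) P) (H-weight i y))))
           (first-step R (x + 2 , suc y) (suc (i + y) * suc (suc (i + y))) (λ P → trans
             (if-* (does (endsAt? (x + 2 , suc y) P)) ((y + i + 1) * (y + i + 2)))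
             (cong (_* contribution (x + 2 , suc y) P) (R-weight i y)))) ⟩
    2 * suc (i + y) * pathSum l (suc x , y) +
      suc (i + y) * suc (suc (i + y)) * pathSum l (x + 2 , suc y) ∎)
    where
    open ≡-Reasoning
    S = stepSeqs l
    H-weight : ∀ i y → 2 * i + 2 * (y + 1) ≡ 2 * suc (i + y)
    H-weight = solve-∀
    R-weight : ∀ i y → (y + i + 1) * (y + i + 2) ≡ suc (i + y) * suc (suc (i + y))
    R-weight = solve-∀
    first-step : ∀ s p a → (∀ P → contribution (x , y) (s ∷ P) ≡ a * contribution p P) →
      sum (map (contribution (x , y)) (map (s ∷_) S)) ≡ a * pathSum l p
    first-step s p a h = trans (sumMap-∘ (contribution (x , y)) (s ∷_) S)
      (trans (sumMap-cong S (λ {P} _ → h P)) (sumMap-* a (contribution p) S))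

  contribution-≢ : ∀ {p} → p ≢ (N , k) → contribution p [] ≡ 0
  contribution-≢ {p} p≢ rewrite dec-false (≡-dec _≟_ _≟_ p (N , k)) p≢ = refl

  contribution-≡ : contribution (N , k) [] ≡ 1
  contribution-≡ rewrite dec-true (≡-dec _≟_ _≟_ (N , k) (N , k)) refl = refl

  shift-R : ∀ x → suc (suc (x + k)) ≡ x + 2 + k
  shift-R x = cong (_+ k) (+-comm 2 x)

  -- The difference x - y grows with each step; once it exceeds N - k the endpoint is out of reach.
  pathSum-beyond : ∀ l x y → N + y < x + k → pathSum l (x , y) ≡ 0
  pathSum-beyond l x y lt = go l
    where
    end≢ : (x , y) ≢ (N , k)
    end≢ refl = <-irrefl refl lt
    go : ∀ l → pathSum l (x , y) ≡ 0
    go zero    = cong (_+ 0) (contribution-≢ end≢)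
    go (suc l) = begin
      pathSum (suc l) (x , y) ≡⟨ pathSum-suc l x y ⟩
      contribution (x , y) [] + (2 * suc (i + y) * pathSum l (suc x , y) + b * pathSum l (x + 2 , suc y))
        ≡⟨ cong₂ _+_ (contribution-≢ end≢)
             (cong₂ (λ u v → 2 * suc (i + y) * u + b * v)
               (pathSum-beyond l (suc x) y (m<n⇒m<1+n lt))
               (pathSum-beyond l (x + 2) (suc y) (subst₂ _≤_ (cong suc (sym (+-suc N y))) (shift-R x)
                 (s≤s (m<n⇒m<1+n lt))))) ⟩
      2 * suc (i + y) * 0 + b * 0 ≡⟨ cong₂ _+_ (*-zeroʳ (2 * suc (i + y))) (*-zeroʳ b) ⟩
      0 ∎
      where
      open ≡-Reasoning
      b = suc (i + y) * suc (suc (i + y))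

  -- The number `g` of remaining steps is how far x - y falls short of N - k. Sequences of any other
  -- length miss the endpoint, so every bound `l` of at least `g` gives the same sum.
  pathSum-climb : ∀ g l x y → g ≤ l → N + y ≡ g + (x + k) → pathSum l (x , y) ≡ climb g (i + y) (i + k)
  pathSum-climb zero l x y _ e = trans (stop l) ends
    where
    ends : contribution (x , y) [] ≡ climb 0 (i + y) (i + k)
    ends with y ≟ k
    ... | no y≢k = trans (contribution-≢ {x , y} (y≢k ∘ cong proj₂)) (sym (climb-≢ (y≢k ∘ +-cancelˡ-≡ i y k)))
    ... | yes refl with refl ← +-cancelʳ-≡ y N x e = trans contribution-≡ (sym (climb-diag (i + y)))
    -- With no step left to make, every nonempty sequence overshoots.
    stop : ∀ l → pathSum l (x , y) ≡ contribution (x , y) []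
    stop zero    = +-identityʳ _
    stop (suc l) = begin
      pathSum (suc l) (x , y) ≡⟨ pathSum-suc l x y ⟩
      contribution (x , y) [] + (2 * suc (i + y) * pathSum l (suc x , y) + b * pathSum l (x + 2 , suc y))
        ≡⟨ cong (contribution (x , y) [] +_) (cong₂ (λ u v → 2 * suc (i + y) * u + b * v)
             (pathSum-beyond l (suc x) y (s≤s (≤-reflexive e)))
             (pathSum-beyond l (x + 2) (suc y) (subst₂ _≤_ (cong suc (sym (+-suc N y))) (shift-R x)
                 (s≤s (s≤s (≤-reflexive e)))))) ⟩
      contribution (x , y) [] + (2 * suc (i + y) * 0 + b * 0)
        ≡⟨ cong (contribution (x , y) [] +_) (cong₂ _+_ (*-zeroʳ (2 * suc (i + y))) (*-zeroʳ b)) ⟩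
      contribution (x , y) [] + 0 ≡⟨ +-identityʳ _ ⟩
      contribution (x , y) [] ∎
      where
      open ≡-Reasoning
      b = suc (i + y) * suc (suc (i + y))
  pathSum-climb (suc g) (suc l) x y (s≤s g≤l) e = begin
    pathSum (suc l) (x , y) ≡⟨ pathSum-suc l x y ⟩
    contribution (x , y) [] + (2 * suc (i + y) * pathSum l (suc x , y) + b * pathSum l (x + 2 , suc y))
      ≡⟨ cong₂ _+_ (contribution-≢ end≢) (cong₂ (λ u v → 2 * suc (i + y) * u + b * v)
           (pathSum-climb g l (suc x) y g≤l (trans e (sym (+-suc g (x + k)))))
           (trans (pathSum-climb g l (x + 2) (suc y) g≤l (begin
              N + suc y              ≡⟨ +-suc N y ⟩
              suc (N + y)            ≡⟨ cong suc e ⟩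
              suc (suc (g + (x + k))) ≡⟨ cong suc (+-suc g (x + k)) ⟨
              suc (g + suc (x + k))   ≡⟨ +-suc g (suc (x + k)) ⟨
              g + suc (suc (x + k))  ≡⟨ cong (g +_) (shift-R x) ⟩
              g + (x + 2 + k)        ∎))
             (cong (λ z → climb g z (i + k)) (+-suc i y)))) ⟩
    climb (suc g) (i + y) (i + k) ∎
    where
    open ≡-Reasoning
    b = suc (i + y) * suc (suc (i + y))
    end≢ : (x , y) ≢ (N , k)
    end≢ refl = m≢1+n+m (N + k) {g} e

w-climb : ∀ i r N k g → N ≡ g + (r + k) → w i r N k ≡ climb g i (i + k)
w-climb i r N k g e = begin
  w i r N k                       ≡⟨ sum-map-filter (EndsAt? r N k) (weightFrom i (r , 0)) (stepSeqs (N ∸ r)) ⟩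
  pathSum i N k (N ∸ r) (r , 0)   ≡⟨ pathSum-climb i N k g (N ∸ r) r 0 g≤ (trans (+-identityʳ N) e) ⟩
  climb g (i + 0) (i + k)         ≡⟨ cong (λ z → climb g z (i + k)) (+-identityʳ i) ⟩
  climb g i (i + k)               ∎
  where
  open ≡-Reasoning
  g≤ : g ≤ N ∸ r
  g≤ = m+n≤o⇒m≤o∸n g (≤-trans (+-monoʳ-≤ g (m≤m+n r k)) (≤-reflexive (sym e)))

-- Gaps between blocks as sums over paths

Σto-applyUpTo : ∀ K f → Σto K f ≡ sum (applyUpTo f (suc K))
Σto-applyUpTo K f = cong sum (map-upTo f (suc K))

sum-applyUpTo-last : ∀ f n → sum (applyUpTo f (suc n)) ≡ sum (applyUpTo f n) + f n
sum-applyUpTo-last f n = begin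
  sum (applyUpTo f (suc n))       ≡⟨ cong sum (applyUpTo-∷ʳ f n) ⟨
  sum (applyUpTo f n ∷ʳ f n)      ≡⟨ sum-++ (applyUpTo f n) [ f n ] ⟩
  sum (applyUpTo f n) + (f n + 0) ≡⟨ cong (sum (applyUpTo f n) +_) (+-identityʳ (f n)) ⟩
  sum (applyUpTo f n) + f n       ∎
  where open ≡-Reasoning

Σto-cong : ∀ K {f g} → (∀ i → i ≤ K → f i ≡ g i) → Σto K f ≡ Σto K g
Σto-cong K f≗g = sumMap-cong (upTo (suc K)) (λ i∈ → f≗g _ (≤-pred (∈-upTo⁻ i∈)))

Σto-last : ∀ K f → (∀ i → i < K → f i ≡ 0) → Σto K f ≡ f K
Σto-last K f f≡0 = begin
  Σto K f                     ≡⟨ Σto-applyUpTo K f ⟩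
  sum (applyUpTo f (suc K))   ≡⟨ sum-applyUpTo-last f K ⟩
  sum (applyUpTo f K) + f K   ≡⟨ cong (_+ f K) (vanish f K f≡0) ⟩
  f K                         ∎
  where
  open ≡-Reasoning
  vanish : ∀ f K → (∀ i → i < K → f i ≡ 0) → sum (applyUpTo f K) ≡ 0
  vanish f zero    f≡0 = refl
  vanish f (suc K) f≡0 = cong₂ _+_ (f≡0 0 (s≤s z≤n)) (vanish (f ∘ suc) K (λ i i<K → f≡0 (suc i) (s≤s i<K)))

Σto-shift : ∀ K f → f 0 ≡ 0 → f (suc K) ≡ 0 → Σto K f ≡ Σto K (f ∘ suc)
Σto-shift K f f0 fK = begin
  Σto K f                               ≡⟨ Σto-applyUpTo K f ⟩
  sum (applyUpTo f (suc K))             ≡⟨ +-identityʳ _ ⟨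
  sum (applyUpTo f (suc K)) + 0         ≡⟨ cong (sum (applyUpTo f (suc K)) +_) fK ⟨
  sum (applyUpTo f (suc K)) + f (suc K) ≡⟨ sum-applyUpTo-last f (suc K) ⟨
  f 0 + sum (applyUpTo (f ∘ suc) (suc K)) ≡⟨ cong (_+ sum (applyUpTo (f ∘ suc) (suc K))) f0 ⟩
  sum (applyUpTo (f ∘ suc) (suc K))     ≡⟨ Σto-applyUpTo K (f ∘ suc) ⟨
  Σto K (f ∘ suc)                       ∎
  where open ≡-Reasoning

replicate-∷ : ∀ {A : Set} g (b : A) xs → replicate g b ++ b ∷ xs ≡ b ∷ replicate g b ++ xs
replicate-∷ zero    b xs = refl
replicate-∷ (suc g) b xs = cong (b ∷_) (replicate-∷ g b xs)

-- From the bottom up, the walk through the gap leads from state `suc i` to `suc K`. An up step from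
-- `suc i` weighs `suc (suc i)` in `transfer` and `suc i * suc (suc i)` in `climb`; the surplus
-- factors multiply to K!/i!, which the two factorials absorb.
transfer-gap : ∀ g K X → transfer X 0 ≡ 0 →
  K ! * transfer (replicate g false ++ X) (suc K) ≡
  Σto K (λ i → climb g i K * (i ! * transfer X (suc i)))
transfer-gap zero K X X0 = sym (trans
  (Σto-last K _ (λ i i<K → cong (_* (i ! * transfer X (suc i))) (climb-≢ (<⇒≢ i<K))))
  (trans (cong (_* (K ! * transfer X (suc K))) (climb-diag K)) (*-identityˡ _)))
transfer-gap (suc g) K X X0 = begin
  K ! * transfer (false ∷ replicate g false ++ X) (suc K)
    -- The lowest letter of the gap is split off, because `climb` splits off the step at its lower
    -- end.
    ≡⟨ cong (λ z → K ! * transfer z (suc K)) (replicate-∷ g false X) ⟨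
  K ! * transfer (replicate g false ++ false ∷ X) (suc K)
    ≡⟨ transfer-gap g K (false ∷ X) refl ⟩
  Σto K (λ i → climb g i K * (i ! * (suc i * (transfer X i + 2 * transfer X (suc i)))))
    ≡⟨ Σto-cong K (λ i _ → expand (climb g i K) (i !) i (transfer X i) (transfer X (suc i))) ⟩
  Σto K (λ i → A i + B i)
    ≡⟨ sumMap-+ A B (upTo (suc K)) ⟩
  Σto K A + Σto K B
    -- `A` collects the up steps, indexed by their upper end, and is reindexed by the lower end. It
    -- vanishes at 0 by `X0` and at `suc K` because walks never descend.
    ≡⟨ cong (_+ Σto K B) (Σto-shift K A
         (trans (cong (climb g 0 K * (0 ! * 1) *_) X0) (*-zeroʳ (climb g 0 K * (0 ! * 1))))
         (cong (λ z → z * (suc K ! * suc (suc K)) * transfer X (suc K)) (climb-> g ≤-refl))) ⟩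
  Σto K (A ∘ suc) + Σto K B
    ≡⟨ sumMap-+ (A ∘ suc) B (upTo (suc K)) ⟨
  Σto K (λ i → A (suc i) + B i)
    ≡⟨ Σto-cong K (λ i _ → collect (climb g i K) (climb g (suc i) K) (i !) i (transfer X (suc i))) ⟩
  Σto K (λ i → climb (suc g) i K * (i ! * transfer X (suc i))) ∎
  where
  open ≡-Reasoning
  A B : ℕ → ℕ
  A i = climb g i K * (i ! * suc i) * transfer X i
  B i = climb g i K * (i ! * suc i) * (2 * transfer X (suc i))
  expand : ∀ c f i t₀ t₁ → c * (f * (suc i * (t₀ + 2 * t₁))) ≡
           c * (f * suc i) * t₀ + c * (f * suc i) * (2 * t₁)
  expand = solve-∀
  collect : ∀ c c′ f i t → c′ * (suc i * f * suc (suc i)) * t + c * (f * suc i) * (2 * t) ≡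
            (2 * suc i * c + suc i * suc (suc i) * c′) * (f * t)
  collect = solve-∀

-- Block decomposition

bitsOf-cong : ∀ N {p q} → (∀ j → j ≤ N → (j ∈ p → j ∈ q) × (j ∈ q → j ∈ p)) → bitsOf N p ≡ bitsOf N q
bitsOf-cong zero            same = refl
bitsOf-cong (suc N) {p} {q} same = cong₂ _∷_
  (does-⇔ (mk⇔ (proj₁ (same (suc N) ≤-refl)) (proj₂ (same (suc N) ≤-refl))) (suc N ∈? p) (suc N ∈? q))
  (bitsOf-cong N (λ j j≤N → same j (m≤n⇒m≤1+n j≤N)))

bitsOf-∈ : ∀ k M {T} → (∀ j → M < j → j ≤ k + M → j ∈ T) → bitsOf (k + M) T ≡ replicate k true ++ bitsOf M T
bitsOf-∈ zero    M     _  = refl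
bitsOf-∈ (suc k) M {T} ∈T = cong₂ _∷_
  (dec-true (suc (k + M) ∈? T) (∈T _ (s≤s (m≤n+m M k)) ≤-refl))
  (bitsOf-∈ k M (λ j M<j j≤ → ∈T j M<j (m≤n⇒m≤1+n j≤)))

bitsOf-∉ : ∀ k M {T} → (∀ j → j ∈ T → j ≤ M) → bitsOf (k + M) T ≡ replicate k false ++ bitsOf M T
bitsOf-∉ zero    M     _  = refl
bitsOf-∉ (suc k) M {T} ≤M = cong₂ _∷_
  (dec-false (suc (k + M) ∈? T) (λ j∈ → <⇒≱ (s≤s (m≤n+m M k)) (≤M _ j∈)))
  (bitsOf-∉ k M ≤M)

bitsOf-interval : ∀ {r k} T → k ≤ r →
  bitsOf r (interval (suc r ∸ k) r ++ T) ≡ replicate k true ++ bitsOf (r ∸ k) T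
bitsOf-interval {r} {k} T k≤r rewrite +-∸-assoc 1 k≤r = begin
  bitsOf r S                             ≡⟨ cong (λ n → bitsOf n S) (m+[n∸m]≡n k≤r) ⟨
  bitsOf (k + (r ∸ k)) S                 ≡⟨ bitsOf-∈ k (r ∸ k) (λ j <j j≤ →
                                              ∈-++⁺ˡ (∈-interval⁺ <j (subst (j ≤_) (m+[n∸m]≡n k≤r) j≤))) ⟩
  replicate k true ++ bitsOf (r ∸ k) S   ≡⟨ cong (replicate k true ++_)
                                              (bitsOf-cong (r ∸ k) (λ j j≤ → below j≤ , ∈-++⁺ʳ _)) ⟩
  replicate k true ++ bitsOf (r ∸ k) T   ∎
  where
  open ≡-Reasoning
  S = interval (suc (r ∸ k)) r ++ T
  below : ∀ {j} → j ≤ r ∸ k → j ∈ S → j ∈ T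
  below j≤ j∈ with ∈-++⁻ (interval (suc (r ∸ k)) r) j∈
  ... | inj₁ j∈I = contradiction j≤ (<⇒≱ (proj₁ (∈-interval⁻ j∈I)))
  ... | inj₂ j∈T = j∈T

-- Blocks are listed from the top, as `transfer` reads them. The strict inequalities leave at least
-- one letter below each block, so the bits below the lowest block are never empty.
data Descending : List (ℕ × ℕ) → Set where
  lowest : ∀ {r k} → k < r → Descending [ (r , k) ]
  _∷_ : ∀ {r k r′ k′ ds} → r′ + k < r → Descending ((r′ , k′) ∷ ds) → Descending ((r , k) ∷ (r′ , k′) ∷ ds)

Descending-head : ∀ {r k ds} → Descending ((r , k) ∷ ds) → k < r
Descending-head (lowest k<r)           = k<r
Descending-head (_∷_ {r′ = r′} lt _) = <-≤-trans (s≤s (m≤n+m _ r′)) lt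

-- `reverse` is a left fold, so the induction carries its accumulator `b ∷ ds`.
reverse-Descending : ∀ {b} ds bs → Descending (b ∷ ds) → Spaced (b ∷ bs) →
                     Descending (foldl (flip _∷_) (b ∷ ds) bs)
reverse-Descending ds []              desc _          = desc
reverse-Descending {r , k} ds ((r′ , k′) ∷ bs) desc (sp∷ gap sp) =
  reverse-Descending ((r , k) ∷ ds) bs (subst (_≤ r′) (+-comm (r + k′) 1) gap ∷ desc) sp

setOfType-range : ∀ {r k ds} → Descending ((r , k) ∷ ds) → InRange r (setOfType ((r , k) ∷ ds))
setOfType-range {r} {k} {ds} desc = All.tabulate (λ x∈ → range desc (∈-++⁻ (interval (suc r ∸ k) r) x∈))
  where
  range : ∀ {ds x} → Descending ((r , k) ∷ ds) → x ∈ interval (suc r ∸ k) r ⊎ x ∈ setOfType ds → 1 ≤ x × x ≤ r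
  range desc (inj₁ x∈) with lo , hi ← ∈-interval⁻ x∈ =
    ≤-trans (m<n⇒0<n∸m (m<n⇒m<1+n (Descending-head desc))) lo , hi
  range (lt ∷ desc) (inj₂ x∈) with lo , hi ← All.lookup (setOfType-range desc) x∈ =
    lo , ≤-trans hi (≤-trans (m≤m+n _ k) (<⇒≤ lt))

transfer-bitsOf-0 : ∀ {N} T → 1 ≤ N → transfer (bitsOf N T) 0 ≡ 0
transfer-bitsOf-0 {suc N} T _ = transfer-0 (suc N ∈ᵇ T) (bitsOf N T)

-- The successive states `suc i`, ..., `k + i` complete `i !` to `(k + i) !`; keeping both
-- factorials avoids division.
transfer-peaks : ∀ k i X → i ! * transfer (replicate k true ++ X) (suc i) ≡ (k + i) ! * transfer X (suc (k + i))
transfer-peaks zero    i X = refl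
transfer-peaks (suc k) i X = begin
  i ! * (suc i * transfer Y (suc (suc i))) ≡⟨ shuffle (i !) (suc i) _ ⟩
  suc i ! * transfer Y (suc (suc i))       ≡⟨ transfer-peaks k (suc i) X ⟩
  (k + suc i) ! * transfer X (suc (k + suc i)) ≡⟨ cong (λ z → z ! * transfer X (suc z)) (+-suc k i) ⟩
  suc (k + i) ! * transfer X (suc (suc (k + i))) ∎
  where
  open ≡-Reasoning
  Y = replicate k true ++ X
  shuffle : ∀ a b c → a * (b * c) ≡ b * a * c
  shuffle = solve-∀

-- Above all peaks there is a single block, which each letter extends at one of its two ends;
-- opening it there would leave lower letters without any block.
transfer-top-gap : ∀ g X → transfer X 0 ≡ 0 → transfer (replicate g false ++ X) 1 ≡ 2 ^ g * transfer X 1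
transfer-top-gap zero    X X0 = sym (*-identityˡ _)
transfer-top-gap (suc g) X X0 = begin
  1 * (transfer Y 0 + 2 * transfer Y 1) ≡⟨ *-identityˡ _ ⟩
  transfer Y 0 + 2 * transfer Y 1       ≡⟨ cong₂ (λ a b → a + 2 * b) (Y0 g) (transfer-top-gap g X X0) ⟩
  2 * (2 ^ g * transfer X 1)            ≡⟨ *-assoc 2 (2 ^ g) _ ⟨
  2 * 2 ^ g * transfer X 1              ∎
  where
  open ≡-Reasoning
  Y = replicate g false ++ X
  Y0 : ∀ g → transfer (replicate g false ++ X) 0 ≡ 0
  Y0 zero    = X0
  Y0 (suc _) = refl

cp-transfer′ : ∀ {N T} → 1 ≤ N → InRange N T → cp N T ≡ transfer (bitsOf N T) 1
cp-transfer′ {suc N} {T} _ = cp-transfer N T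

-- The nested sum is the walk below the block `(r , k)` when that block is entered at state
-- `suc ip`. The factorial in front is the one `transfer-gap` starts from; the `i !` it leaves
-- behind is completed to the next one by `transfer-peaks`.
nested-transfer : ∀ ip {r k} ds → Descending ((r , k) ∷ ds) →
  nested ip ((r , k) ∷ ds) ≡ (k + ip) ! * transfer (bitsOf (r ∸ k) (setOfType ds)) (suc (k + ip))
nested-transfer ip {r} {k} [] desc@(lowest k<r) = begin
  -- The lowest block has `ip` extra peaks on top: read from state 1, they lead to state `suc ip`
  -- and supply the factor `ip !`.
  cp (r + ip) (interval (suc r ∸ k) (r + ip))
    ≡⟨ cong (λ a → cp (r + ip) (interval a (r + ip))) (cancel (suc r)) ⟩
  cp (r + ip) I
    ≡⟨ cp-transfer′ (≤-trans (s≤s z≤n) (<-≤-trans k<r (m≤m+n r ip)))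
         (subst (InRange (r + ip)) (++-identityʳ I) (setOfType-range (lowest (+-monoˡ-< ip k<r)))) ⟩
  transfer (bitsOf (r + ip) I) 1
    ≡⟨ cong (λ T → transfer (bitsOf (r + ip) T) 1) (++-identityʳ I) ⟨
  transfer (bitsOf (r + ip) (I ++ [])) 1
    ≡⟨ cong (λ X → transfer X 1) (bitsOf-interval [] (+-monoˡ-≤ ip (<⇒≤ k<r))) ⟩
  transfer (replicate (k + ip) true ++ bitsOf (r + ip ∸ (k + ip)) []) 1
    ≡⟨ cong (λ M → transfer (replicate (k + ip) true ++ bitsOf M []) 1) (cancel r) ⟨
  transfer (replicate (k + ip) true ++ bitsOf (r ∸ k) []) 1
    ≡⟨ *-identityˡ _ ⟨
  0 ! * transfer (replicate (k + ip) true ++ bitsOf (r ∸ k) []) 1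
    ≡⟨ transfer-peaks (k + ip) 0 _ ⟩
  (k + ip + 0) ! * transfer (bitsOf (r ∸ k) []) (suc (k + ip + 0))
    ≡⟨ cong (λ z → z ! * transfer (bitsOf (r ∸ k) []) (suc z)) (+-identityʳ (k + ip)) ⟩
  (k + ip) ! * transfer (bitsOf (r ∸ k) []) (suc (k + ip)) ∎
  where
  open ≡-Reasoning
  I = interval (suc (r + ip) ∸ (k + ip)) (r + ip)
  cancel : ∀ a → a ∸ k ≡ a + ip ∸ (k + ip)
  cancel a = sym (trans (cong₂ _∸_ (+-comm a ip) (+-comm k ip)) ([m+n]∸[m+o]≡n∸o ip a k))
nested-transfer ip {r} {k} ((r′ , k′) ∷ ds) (lt ∷ desc) = begin
  Σto K (λ i → w i r′ (r + ip ∸ i) (K ∸ i) * nested i ((r′ , k′) ∷ ds))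
    ≡⟨ Σto-cong K (λ i i≤K → cong₂ _*_ (weight i i≤K) (lower i)) ⟩
  Σto K (λ i → climb g i K * (i ! * transfer X (suc i)))
    ≡⟨ transfer-gap g K X (transfer-bitsOf-0 (setOfType ((r′ , k′) ∷ ds))
                                   (≤-trans (s≤s z≤n) (Descending-head desc))) ⟨
  K ! * transfer (replicate g false ++ X) (suc K)
    ≡⟨ cong (λ Z → K ! * transfer Z (suc K))
              (bitsOf-∉ g r′ (λ j j∈ → proj₂ (All.lookup (setOfType-range desc) j∈))) ⟨
  K ! * transfer (bitsOf (g + r′) (setOfType ((r′ , k′) ∷ ds))) (suc K)
    ≡⟨ cong (λ M → K ! * transfer (bitsOf M (setOfType ((r′ , k′) ∷ ds))) (suc K)) (m∸n+n≡m r′≤r∸k) ⟩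
  K ! * transfer (bitsOf (r ∸ k) (setOfType ((r′ , k′) ∷ ds))) (suc K) ∎
  where
  open ≡-Reasoning
  K = k + ip
  g = r ∸ k ∸ r′
  X = bitsOf r′ (setOfType ((r′ , k′) ∷ ds))
  r′≤r∸k : r′ ≤ r ∸ k
  r′≤r∸k = m+n≤o⇒m≤o∸n r′ (<⇒≤ lt)
  k≤r : k ≤ r
  k≤r = ≤-trans (m≤n+m k r′) (<⇒≤ lt)
  split-r : r ≡ g + r′ + k
  split-r = sym (trans (cong (_+ k) (m∸n+n≡m r′≤r∸k)) (m∸n+n≡m k≤r))
  -- The paths in the factor `w` make `g` steps, one for each letter strictly between the two
  -- blocks.
  endpoint-x : ∀ i → i ≤ K → r + ip ∸ i ≡ g + (r′ + (K ∸ i))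
  endpoint-x i i≤K = begin
    r + ip ∸ i              ≡⟨ cong (λ z → z + ip ∸ i) split-r ⟩
    g + r′ + k + ip ∸ i     ≡⟨ cong (_∸ i) (+-assoc (g + r′) k ip) ⟩
    g + r′ + K ∸ i          ≡⟨ +-∸-assoc (g + r′) i≤K ⟩
    g + r′ + (K ∸ i)        ≡⟨ +-assoc g r′ (K ∸ i) ⟩
    g + (r′ + (K ∸ i))      ∎
  weight : ∀ i → i ≤ K → w i r′ (r + ip ∸ i) (K ∸ i) ≡ climb g i K
  weight i i≤K = trans (w-climb i r′ _ (K ∸ i) g (endpoint-x i i≤K)) (cong (climb g i) (m+[n∸m]≡n i≤K))
  lower : ∀ i → nested i ((r′ , k′) ∷ ds) ≡ i ! * transfer X (suc i)
  lower i = begin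
    nested i ((r′ , k′) ∷ ds)
      ≡⟨ nested-transfer i ds desc ⟩
    (k′ + i) ! * transfer (bitsOf (r′ ∸ k′) (setOfType ds)) (suc (k′ + i))
      ≡⟨ transfer-peaks k′ i _ ⟨
    i ! * transfer (replicate k′ true ++ bitsOf (r′ ∸ k′) (setOfType ds)) (suc i)
      ≡⟨ cong (λ Z → i ! * transfer Z (suc i)) (bitsOf-interval (setOfType ds) (<⇒≤ (Descending-head desc))) ⟨
    i ! * transfer X (suc i) ∎

∈-setOfType-reverse : ∀ bs {x} → (x ∈ setOfType bs → x ∈ setOfType (reverse bs)) ×
                                 (x ∈ setOfType (reverse bs) → x ∈ setOfType bs)
∈-setOfType-reverse bs =
  (λ x∈ → ∈-concatMap⁺ _ (reverse⁺ (∈-concatMap⁻ _ {xs = bs} x∈))) ,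
  (λ x∈ → ∈-concatMap⁺ _ (reverse⁻ {xs = bs} (∈-concatMap⁻ _ {xs = reverse bs} x∈)))

-- The letters above `r` give the power of 2 and leave the top block entered at state 1, that is
-- `ip = 0`. The equation for `reverse bs` exposes this block.
cp-reverse : ∀ {n r k} bs ds → reverse bs ≡ (r , k) ∷ ds → Descending ((r , k) ∷ ds) → r ≤ n →
  cp n (setOfType bs) ≡ 2 ^ (n ∸ r) * nested 0 (reverse bs)
cp-reverse {n} {r} {k} bs ds rev desc r≤n = begin
  cp n S
    ≡⟨ cp-transfer′ (≤-trans (s≤s z≤n) (≤-trans (Descending-head desc) r≤n))
         (All.tabulate (λ x∈ → let (lo , hi) = All.lookup (setOfType-range desc) (to x∈) in lo , ≤-trans hi r≤n)) ⟩
  transfer (bitsOf n S) 1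
    ≡⟨ cong (λ X → transfer X 1) (bitsOf-cong n (λ j _ → to , from)) ⟩
  transfer (bitsOf n D) 1
    ≡⟨ cong (λ N → transfer (bitsOf N D) 1) (m∸n+n≡m r≤n) ⟨
  transfer (bitsOf (n ∸ r + r) D) 1
    ≡⟨ cong (λ X → transfer X 1) (bitsOf-∉ (n ∸ r) r (λ j j∈ → proj₂ (All.lookup (setOfType-range desc) j∈))) ⟩
  transfer (replicate (n ∸ r) false ++ bitsOf r D) 1
    ≡⟨ transfer-top-gap (n ∸ r) (bitsOf r D) (transfer-bitsOf-0 D (≤-trans (s≤s z≤n) (Descending-head desc))) ⟩
  2 ^ (n ∸ r) * transfer (bitsOf r D) 1
    ≡⟨ cong (2 ^ (n ∸ r) *_) top ⟩
  2 ^ (n ∸ r) * nested 0 ((r , k) ∷ ds)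
    ≡⟨ cong (λ z → 2 ^ (n ∸ r) * nested 0 z) rev ⟨
  2 ^ (n ∸ r) * nested 0 (reverse bs) ∎
  where
  open ≡-Reasoning
  S = setOfType bs
  D = setOfType ((r , k) ∷ ds)
  to : ∀ {x} → x ∈ S → x ∈ D
  to {x} x∈ = subst (λ z → x ∈ setOfType z) rev (proj₁ (∈-setOfType-reverse bs) x∈)
  from : ∀ {x} → x ∈ D → x ∈ S
  from {x} x∈ = proj₂ (∈-setOfType-reverse bs) (subst (λ z → x ∈ setOfType z) (sym rev) x∈)
  top : transfer (bitsOf r D) 1 ≡ nested 0 ((r , k) ∷ ds)
  top = begin
    transfer (bitsOf r D) 1
      ≡⟨ cong (λ X → transfer X 1) (bitsOf-interval (setOfType ds) (<⇒≤ (Descending-head desc))) ⟩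
    transfer (replicate k true ++ bitsOf (r ∸ k) (setOfType ds)) 1
      ≡⟨ *-identityˡ _ ⟨
    0 ! * transfer (replicate k true ++ bitsOf (r ∸ k) (setOfType ds)) 1
      ≡⟨ transfer-peaks k 0 _ ⟩
    (k + 0) ! * transfer (bitsOf (r ∸ k) (setOfType ds)) (suc (k + 0))
      ≡⟨ nested-transfer 0 ds desc ⟨
    nested 0 ((r , k) ∷ ds) ∎

theorem3p2 : (n r₁ k₁ rₘ kₘ : ℕ) (mid : List (ℕ × ℕ)) →
    let bs = (r₁ , k₁) ∷ mid ++ [ (rₘ , kₘ) ] in
    let S = setOfType bs in
    3 ≤ n →
    All (λ b → 1 ≤ proj₂ b) bs →
    Spaced bs →
    3 ≤ 1 + r₁ ∸ k₁ →
    rₘ ≤ n →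
    cp n S ≢ 0 →
    cp n S ≡ 2 ^ (n ∸ rₘ) * nested 0 (reverse bs)
theorem3p2 n r₁ k₁ rₘ kₘ mid _ _ spaced 3≤ rₘ≤n _ =
  cp-reverse bs (reverse ((r₁ , k₁) ∷ mid)) rev
    (subst Descending rev (reverse-Descending [] (mid ++ [ (rₘ , kₘ) ]) (lowest k₁<r₁) spaced)) rₘ≤n
  where
  bs = (r₁ , k₁) ∷ mid ++ [ (rₘ , kₘ) ]
  rev : reverse bs ≡ (rₘ , kₘ) ∷ reverse ((r₁ , k₁) ∷ mid)
  rev = reverse-++ ((r₁ , k₁) ∷ mid) [ (rₘ , kₘ) ]
  k₁<r₁ : k₁ < r₁
  -- If `r₁ ≤ k₁`, then `1 + r₁ ∸ k₁` is at most 1, against `3≤`.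
  k₁<r₁ with k₁ <? r₁
  ... | yes k₁<r₁ = k₁<r₁
  ... | no  k₁≮r₁ = contradiction
    (≤-trans 3≤ (≤-trans (∸-monoʳ-≤ (suc r₁) (≮⇒≥ k₁≮r₁)) (≤-reflexive (m+n∸n≡m 1 r₁)))) λ { (s≤s ()) }
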